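{- A permutation class $\mathcal{C}$ is a Young class if and only if there is a set $D$ of partitions that is downwards closed in the double domination order such that $\mathcal{C} = \{\pi : \mathrm{sh}(\pi) \in D\}$.
   Context: Permutations are identified with their sequences of values. For permutations $\sigma$ (of length $k$) and $\pi$, $\sigma\preceq\pi$ means some length-$k$ subsequence of the values of $\pi$ has its terms in the same relative order as the values of $\sigma$. A permutation class is a set of permutations closed downwards under $\preceq$. For a permutation $\pi$, $\mathrm{sh}(\pi)$ is the partition giving the common shape of the two Young tableaux associated to $\pi$ by the Robinson–Schensted–Knuth correspondence. A Young class is a permutation class $\mathcal{C}$ such that for each partition $\lambda$, either all permutations of shape $\lambda$ belong to $\mathcal{C}$ or none do. A partition is a weakly decreasing sequence of positive integers, regarded as extended by trailing zeros; its conjugate $\lambda^*$ is given by $\lambda^*_i=|\{j:\lambda_j\ge i\}|$. $\lambda\trianglelefteq\mu$ means $\sum_{i=1}^k\lambda_i\le\sum_{i=1}^k\mu_i$ for all $k\ge1$; the double domination order is $\lambda\sqsubseteq\mu$ iff $\lambda\trianglelefteq\mu$ and $\lambda^*\trianglelefteq\mu^*$. A set $D$ of partitions is downwards closed if $\mu\in D$ and $\lambda\sqsubseteq\mu$ imply $\lambda\in D$. -}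

module Defs where

open import Data.Nat using (ℕ; zero; suc; _+_; _≤_; _<_; _≥_; _<?_; _≤?_; _⊔_)
open import Data.List using (List; []; _∷_; length; map; filter; take; upTo; foldr; foldl)
open import Data.Nat.ListAction using (sum)
open import Data.List.Relation.Unary.All using (All)
open import Data.List.Relation.Unary.Linked using (Linked)
open import Data.List.Relation.Binary.Pointwise using (Pointwise)
open import Data.List.Relation.Binary.Permutation.Propositional using (_↭_)
open import Data.List.Relation.Binary.Sublist.Propositional using (_⊆_)
open import Data.Product using (Σ; ∃; _×_; _,_; proj₁)
open import Data.Maybe using (Maybe; just; nothing)
open import Relation.Nullary using (yes; no)
open import Function.Bundles using (_⇔_)

-- Permutations: a permutation of length n is identified with its sequence
-- of values, a list which is a rearrangement of 0,1,…,n-1.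

IsPermutation : List ℕ → Set
IsPermutation xs = xs ↭ upTo (length xs)

Perm : Set
Perm = Σ (List ℕ) IsPermutation

data OrderIso : List ℕ → List ℕ → Set where
  []  : OrderIso [] []
  _∷_ : ∀ {x y xs ys} →
        Pointwise (λ x′ y′ → (x < x′ ⇔ y < y′) × (x′ < x ⇔ y′ < y)) xs ys →
        OrderIso xs ys → OrderIso (x ∷ xs) (y ∷ ys)

_≼_ : Perm → Perm → Set
σ ≼ π = ∃ λ ys → (ys ⊆ proj₁ π) × OrderIso (proj₁ σ) ys

IsPermClass : (Perm → Set) → Set
IsPermClass C = ∀ σ π → σ ≼ π → C π → C σ

rowInsert : ℕ → List ℕ → Maybe ℕ × List ℕ
rowInsert x [] = nothing , x ∷ []
rowInsert x (y ∷ ys) with x <? y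
... | yes _ = just y , x ∷ ys
... | no _ with rowInsert x ys
...   | (b , ys′) = b , y ∷ ys′

-- Insertion of x into a tableau (list of rows, top row first).
insert : ℕ → List (List ℕ) → List (List ℕ)
insert x [] = (x ∷ []) ∷ []
insert x (r ∷ rs) with rowInsert x r
... | (nothing , r′) = r′ ∷ rs
... | (just b  , r′) = r′ ∷ insert b rs

insertionTableau : List ℕ → List (List ℕ)
insertionTableau = foldl (λ t x → insert x t) []

sh : Perm → List ℕ
sh π = map length (insertionTableau (proj₁ π))

-- Partitions: weakly decreasing lists of positive integers
-- (implicitly extended by trailing zeros).

IsPartition : List ℕ → Set
IsPartition λ′ = All (λ x → 0 < x) λ′ × Linked _≥_ λ′

conj : List ℕ → List ℕ
conj λ′ = map (λ i → length (filter (λ x → suc i ≤? x) λ′)) (upTo (foldr _⊔_ 0 λ′))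

_⊴_ : List ℕ → List ℕ → Set
λ′ ⊴ μ = ∀ k → sum (take k λ′) ≤ sum (take k μ)

_⊑_ : List ℕ → List ℕ → Set
λ′ ⊑ μ = (λ′ ⊴ μ) × (conj λ′ ⊴ conj μ)

IsPartitionSet : (List ℕ → Set) → Set
IsPartitionSet D = ∀ λ′ → D λ′ → IsPartition λ′

DownClosed : (List ℕ → Set) → Set
DownClosed D = ∀ λ′ μ → IsPartition λ′ → IsPartition μ → D μ → λ′ ⊑ μ → D λ′

IsYoungClass : (Perm → Set) → Set
IsYoungClass C = IsPermClass C × (∀ π π′ → sh π ≡ sh π′ → C π → C π′)
  where open import Relation.Binary.PropositionalEquality using (_≡_)

{-# OPTIONS --safe #-}

-- Only the implication from left to right needs work: if λ ⊑ μ and a Young class contains a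
-- permutation of shape μ, it contains one of shape λ. In terms of row lengths, λ ⊑ μ says that no
-- prefix sum and no suffix sum of λ exceeds the corresponding one of μ, and interpolation reduces
-- the claim to |μ| = |λ| + 1. Then the nonzero entries of μ - λ are +1, -1, +1, …, +1, and since
-- the class is closed under changing a permutation without changing its shape, it suffices to
-- exhibit one permutation of shape μ with a subsequence of shape λ. Rows on which μ and λ agree
-- are added by appending a run of small letters. A leading pair of entries +1, -1 is added by
-- surrounding a word t, already realising the remaining rows, as
--   N, …, N+p, 0, t, N+p+1, …, N+p+b, 1, …, a     (0, …, a below and N, … above the letters of t).
-- If t has first row of length r ∈ {p, p+1}, and p+1 ≤ a ≤ b+p, then the new shape consists of rows
-- of lengths 1+b+r and p+1+a-r followed by the shape of t.
module Submission where

open import Defs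
open import Data.Bool using (Bool; true; false)
open import Data.List using (List; []; _∷_; _++_; length; map; take; drop; filter; foldl; foldr; applyUpTo; upTo)
open import Data.List.Membership.Propositional using (_∈_)
open import Data.List.Properties hiding (sum-++)
open import Data.List.Relation.Binary.Permutation.Propositional
  using (_↭_; ↭-refl; ↭-sym; ↭-trans; ↭-reflexive; ↭-prep; ↭⇒↭ₛ; module PermutationReasoning)
open import Data.List.Relation.Binary.Permutation.Propositional.Properties as Perm
  using (shifts; ++-comm; All-resp-↭)
import Data.List.Relation.Binary.Permutation.Setoid.Properties as PermSetoid
open import Data.List.Relation.Binary.Pointwise using (Pointwise; []; _∷_)
open import Data.List.Relation.Binary.Sublist.Propositional using (_⊆_; ⊆-refl; []; _∷_; _∷ʳ_)
import Data.List.Relation.Binary.Sublist.Propositional.Properties as Sub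
open import Data.List.Relation.Unary.All as All using (All; []; _∷_)
import Data.List.Relation.Unary.All.Properties as All
open import Data.List.Relation.Unary.AllPairs as AllPairs using (AllPairs; []; _∷_)
import Data.List.Relation.Unary.AllPairs.Properties as AllPairs
open import Data.List.Relation.Unary.Any using (here; there)
open import Data.List.Relation.Unary.Linked as Linked using (Linked; []; [-]; _∷_)
import Data.List.Relation.Unary.Linked.Properties as Linked
open import Data.List.Relation.Unary.Unique.Propositional using (Unique)
open import Data.Maybe as Maybe using (Maybe; just; nothing)
open import Data.Nat
  using (ℕ; zero; suc; _+_; _*_; _∸_; _⊔_; _⊓_; _≤_; _<_; _≥_; _≤?_; _<?_; z≤n; s≤s; s≤s⁻¹)
open import Data.Nat.ListAction using (sum)
open import Data.Nat.ListAction.Properties using (sum-++)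
open import Data.Nat.Properties hiding (_≤?_; _<?_)
open import Data.List.Sort ≤-decTotalOrder using (sort; sort-↭; sort-↗)
open import Data.Product using (∃; _×_; _,_; proj₁; proj₂)
open import Data.Sum using (_⊎_; inj₁; inj₂)
open import Data.Unit using (⊤; tt)
open import Function using (_∘_)
open import Function.Bundles using (_⇔_; mk⇔; Equivalence)
open import Function.Properties.Equivalence using () renaming (sym to ⇔-sym)
open import Relation.Nullary using (yes; no; contradiction)
open import Relation.Binary.PropositionalEquality

-- Row insertion

Tableau : Set
Tableau = List (List ℕ)

-- The graph of `rowInsert` as an inductive relation: proofs recurse on the insertion path instead
-- of redoing the comparisons.
data RowInsertion (x : ℕ) : List ℕ → Maybe ℕ → List ℕ → Set where
  end  : RowInsertion x [] nothing (x ∷ [])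
  hit  : ∀ {y ys} → x < y → RowInsertion x (y ∷ ys) (just y) (x ∷ ys)
  skip : ∀ {y ys b ys′} → y ≤ x → RowInsertion x ys b ys′ →
         RowInsertion x (y ∷ ys) b (y ∷ ys′)

data Insertion : ℕ → Tableau → Tableau → Set where
  new  : ∀ {x} → Insertion x [] ((x ∷ []) ∷ [])
  stop : ∀ {x r r′ rs} → RowInsertion x r nothing r′ → Insertion x (r ∷ rs) (r′ ∷ rs)
  next : ∀ {x y r r′ rs rs′} → RowInsertion x r (just y) r′ → Insertion y rs rs′ →
         Insertion x (r ∷ rs) (r′ ∷ rs′)

rowInsertion : ∀ x r → RowInsertion x r (proj₁ (rowInsert x r)) (proj₂ (rowInsert x r))
rowInsertion x [] = end
rowInsertion x (y ∷ ys) with x <? y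
... | yes x<y = hit x<y
... | no x≮y with rowInsert x ys | rowInsertion x ys
...   | _ | R = skip (≮⇒≥ x≮y) R

insertion : ∀ x T → Insertion x T (insert x T)
insertion x [] = new
insertion x (r ∷ rs) with rowInsert x r | rowInsertion x r
... | nothing , r′ | R = stop R
... | just b  , r′ | R = next R (insertion b rs)

rowInsertion-unique : ∀ {x r b b′ r₁ r₂} → RowInsertion x r b r₁ → RowInsertion x r b′ r₂ →
                      (b ≡ b′) × (r₁ ≡ r₂)
rowInsertion-unique end end = refl , refl
rowInsertion-unique (hit _) (hit _) = refl , refl
rowInsertion-unique (hit x<y) (skip y≤x _) = contradiction y≤x (<⇒≱ x<y)
rowInsertion-unique (skip y≤x _) (hit x<y) = contradiction y≤x (<⇒≱ x<y)
rowInsertion-unique (skip _ R) (skip _ S) with refl , refl ← rowInsertion-unique R S = refl , refl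

insertion-unique : ∀ {x T T₁ T₂} → Insertion x T T₁ → Insertion x T T₂ → T₁ ≡ T₂
insertion-unique new new = refl
insertion-unique (stop R) (stop S) with _ , refl ← rowInsertion-unique R S = refl
insertion-unique (stop R) (next S _) with () , _ ← rowInsertion-unique R S
insertion-unique (next R _) (stop S) with () , _ ← rowInsertion-unique R S
insertion-unique (next R I) (next S J) with refl , refl ← rowInsertion-unique R S =
  cong (_ ∷_) (insertion-unique I J)

-- Determinism turns a hand-built derivation into an evaluation of `insert`.
insertion⇒≡ : ∀ {x T T′} → Insertion x T T′ → insert x T ≡ T′
insertion⇒≡ {x} {T} I = insertion-unique (insertion x T) I

-- The precedence lies between those of `_≡_` and `_++_`, so `T ⊳ v ++ w` inserts the whole
-- concatenation.
infixl 4.5 _⊳_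

_⊳_ : Tableau → List ℕ → Tableau
T ⊳ w = foldl (λ t x → insert x t) T w

⊳-++ : ∀ T v w → T ⊳ (v ++ w) ≡ T ⊳ v ⊳ w
⊳-++ = foldl-++ _

shape : List ℕ → List ℕ
shape w = map length (insertionTableau w)

AllEntries : (ℕ → Set) → Tableau → Set
AllEntries P = All (All P)

module _ {P : ℕ → Set} where

  rowInsertion-All : ∀ {x r b r′} → P x → All P r → RowInsertion x r b r′ → All P r′
  rowInsertion-All px []         end          = px ∷ []
  rowInsertion-All px (_ ∷ pr)   (hit _)      = px ∷ pr
  rowInsertion-All px (py ∷ pr)  (skip _ R)   = py ∷ rowInsertion-All px pr R

  bumped-P : ∀ {x r y r′} → All P r → RowInsertion x r (just y) r′ → P y
  bumped-P (py ∷ _)  (hit _)    = py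
  bumped-P (_ ∷ pr)  (skip _ R) = bumped-P pr R

  insertion-All : ∀ {x T T′} → P x → AllEntries P T → Insertion x T T′ → AllEntries P T′
  insertion-All px []         new        = (px ∷ []) ∷ []
  insertion-All px (pr ∷ prs) (stop R)   = rowInsertion-All px pr R ∷ prs
  insertion-All px (pr ∷ prs) (next R I) = rowInsertion-All px pr R ∷ insertion-All (bumped-P pr R) prs I

  ⊳-All : ∀ {T} w → All P w → AllEntries P T → AllEntries P (T ⊳ w)
  ⊳-All []      []        pT = pT
  ⊳-All (x ∷ w) (px ∷ pw) pT = ⊳-All w pw (insertion-All px pT (insertion x _))

-- Semistandard tableaux

infixr 5 _∷_

data Over : List ℕ → List ℕ → Set where
  []  : ∀ {r} → Over r []
  _∷_ : ∀ {x y r s} → x < y → Over r s → Over (x ∷ r) (y ∷ s)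

Sorted : List ℕ → Set
Sorted = AllPairs _≤_

record Semistandard (T : Tableau) : Set where
  constructor semistandard
  field
    nonempty : All (λ r → 0 < length r) T
    rows     : All Sorted T
    columns  : Linked Over T

open Semistandard

bumped-> : ∀ {x r y r′} → RowInsertion x r (just y) r′ → x < y
bumped-> (hit x<y)  = x<y
bumped-> (skip _ R) = bumped-> R

rowInsertion-length : ∀ {x r y r′} → RowInsertion x r (just y) r′ → length r′ ≡ length r
rowInsertion-length (hit _)    = refl
rowInsertion-length (skip _ R) = cong suc (rowInsertion-length R)

rowInsertion-append : ∀ {x r r′} → RowInsertion x r nothing r′ → r′ ≡ r ++ x ∷ []
rowInsertion-append end        = refl
rowInsertion-append (skip _ R) = cong (_ ∷_) (rowInsertion-append R)

rowInsertion-sorted : ∀ {x r b r′} → Sorted r → RowInsertion x r b r′ → Sorted r′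
rowInsertion-sorted _ end = [] ∷ []
rowInsertion-sorted (y≤ ∷ s) (hit x<y) = All.map (≤-trans (<⇒≤ x<y)) y≤ ∷ s
rowInsertion-sorted (y≤ ∷ s) (skip y≤x R) = rowInsertion-All y≤x y≤ R ∷ rowInsertion-sorted s R

rowInsertion-nonempty : ∀ {x r b r′} → RowInsertion x r b r′ → 0 < length r′
rowInsertion-nonempty end        = s≤s z≤n
rowInsertion-nonempty (hit _)    = s≤s z≤n
rowInsertion-nonempty (skip _ _) = s≤s z≤n

over-rowInsertion : ∀ {x r b r′ s} → Over r s → RowInsertion x r b r′ → Over r′ s
over-rowInsertion []          _          = []
over-rowInsertion (y<z ∷ o)   (hit x<y)  = <-trans x<y y<z ∷ o
over-rowInsertion (y<z ∷ o)   (skip _ R) = y<z ∷ over-rowInsertion o R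

-- The entry under the bumped letter `y`, if any, exceeds `y`, so `y` comes to rest weakly to the
-- left of the column it left. There the entry above it is `x` or one skipped by `x`, hence smaller.
over-bump : ∀ {x r y r′ s b s′} → Over r s →
            RowInsertion x r (just y) r′ → RowInsertion y s b s′ → Over r′ s′
over-bump []        (hit x<y)     end        = x<y ∷ []
over-bump []        (skip z≤x R)  end        = ≤-<-trans z≤x (bumped-> R) ∷ []
over-bump (_ ∷ o)   (hit x<y)     (hit _)    = x<y ∷ o
over-bump (y<c ∷ _) (hit _)       (skip c≤y _) = contradiction c≤y (<⇒≱ y<c)
over-bump (_ ∷ o)   (skip z≤x R)  (hit _)    = ≤-<-trans z≤x (bumped-> R) ∷ over-rowInsertion o R
over-bump (z<c ∷ o) (skip _ R)    (skip _ S) = z<c ∷ over-bump o R S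

insertion-columns : ∀ {x T T′} → Linked Over T → Insertion x T T′ → Linked Over T′
insertion-columns [] new = [-]
insertion-columns [-] (stop R) = [-]
insertion-columns (o ∷ os) (stop R) = over-rowInsertion o R ∷ os
insertion-columns [-] (next R new) = over-bump [] R end ∷ [-]
insertion-columns (o ∷ os) (next R (stop S)) = over-bump o R S ∷ insertion-columns os (stop S)
insertion-columns (o ∷ os) (next R (next S I)) = over-bump o R S ∷ insertion-columns os (next S I)

insertion-rows : ∀ {x T T′} → All Sorted T → Insertion x T T′ → All Sorted T′
insertion-rows []       new        = ([] ∷ []) ∷ []
insertion-rows (s ∷ ss) (stop R)   = rowInsertion-sorted s R ∷ ss
insertion-rows (s ∷ ss) (next R I) = rowInsertion-sorted s R ∷ insertion-rows ss I

insertion-nonempty : ∀ {x T T′} → All (λ r → 0 < length r) T → Insertion x T T′ →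
                     All (λ r → 0 < length r) T′
insertion-nonempty []       new        = s≤s z≤n ∷ []
insertion-nonempty (_ ∷ ne) (stop R)   = rowInsertion-nonempty R ∷ ne
insertion-nonempty (_ ∷ ne) (next R I) = rowInsertion-nonempty R ∷ insertion-nonempty ne I

⊳-semistandard : ∀ {T} w → Semistandard T → Semistandard (T ⊳ w)
⊳-semistandard [] ss = ss
⊳-semistandard (x ∷ w) (semistandard ne rs cs) =
  ⊳-semistandard w (semistandard (insertion-nonempty ne I) (insertion-rows rs I) (insertion-columns cs I))
  where I = insertion x _

insertionTableau-semistandard : ∀ w → Semistandard (insertionTableau w)
insertionTableau-semistandard w = ⊳-semistandard w (semistandard [] [] [])

over-length : ∀ {r s} → Over r s → length r ≥ length s
over-length []      = z≤n
over-length (_ ∷ o) = s≤s (over-length o)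

shape-partition : ∀ w → IsPartition (shape w)
shape-partition w = All.map⁺ (nonempty ss) , Linked.map⁺ (Linked.map over-length (columns ss))
  where ss = insertionTableau-semistandard w

-- Order-preserving maps of the letters

module _ {P : ℕ → Set} {f : ℕ → ℕ} (f-mono : ∀ {x y} → P x → P y → x < y ⇔ f x < f y) where

  open Equivalence

  -- Insertion only compares letters. The predicate `P` confines the monotonicity of `f` to the
  -- letters that occur, since `rank` need not be injective elsewhere.
  rowInsertion-map : ∀ {x r b r′} → P x → All P r → RowInsertion x r b r′ →
                     RowInsertion (f x) (map f r) (Maybe.map f b) (map f r′)
  rowInsertion-map px []        end          = end
  rowInsertion-map px (py ∷ pr) (hit x<y)    = hit (to (f-mono px py) x<y)
  rowInsertion-map px (py ∷ pr) (skip y≤x R) =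
    skip (≮⇒≥ λ fx<fy → <⇒≱ (from (f-mono px py) fx<fy) y≤x) (rowInsertion-map px pr R)

  insertion-map : ∀ {x T T′} → P x → AllEntries P T → Insertion x T T′ →
                  Insertion (f x) (map (map f) T) (map (map f) T′)
  insertion-map px []         new        = new
  insertion-map px (pr ∷ prs) (stop R)   = stop (rowInsertion-map px pr R)
  insertion-map px (pr ∷ prs) (next R I) =
    next (rowInsertion-map px pr R) (insertion-map (bumped-P pr R) prs I)

  ⊳-map : ∀ {T} w → All P w → AllEntries P T → map (map f) T ⊳ map f w ≡ map (map f) (T ⊳ w)
  ⊳-map []      []        pT = refl
  ⊳-map {T} (x ∷ w) (px ∷ pw) pT = trans
    (cong (_⊳ map f w) (insertion⇒≡ (insertion-map px pT (insertion x T))))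
    (⊳-map w pw (insertion-All px pT (insertion x T)))

map-length-map : ∀ (f : ℕ → ℕ) T → map length (map (map f) T) ≡ map length T
map-length-map f []      = refl
map-length-map f (r ∷ T) = cong₂ _∷_ (length-map f r) (map-length-map f T)

shape-map : ∀ {P : ℕ → Set} {f : ℕ → ℕ} → (∀ {x y} → P x → P y → x < y ⇔ f x < f y) →
            ∀ w → All P w → shape (map f w) ≡ shape w
shape-map {f = f} mono w pw =
  trans (cong (map length) (⊳-map mono w pw [])) (map-length-map f (insertionTableau w))

-- Inserting an increasing sequence

-- Only the common columns are compared: unlike in `Over`, either list may be the longer.
data Below : List ℕ → List ℕ → Set where
  doneˡ : ∀ {r} → Below [] r
  doneʳ : ∀ {ρ} → Below ρ []
  _∷_   : ∀ {x y ρ r} → x < y → Below ρ r → Below (x ∷ ρ) (y ∷ r)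

topRow : Tableau → List ℕ
topRow []      = []
topRow (r ∷ _) = r

rowInsertion-past : ∀ {x α r b r′} → All (_≤ x) α → RowInsertion x r b r′ →
                    RowInsertion x (α ++ r) b (α ++ r′)
rowInsertion-past []         R = R
rowInsertion-past (a≤x ∷ α≤x) R = skip a≤x (rowInsertion-past α≤x R)

-- Each letter of `ρ` replaces the next entry of `r`; once `r` is used up, the remaining letters are
-- appended. Letters already placed join `α`, which later ones skip. The word passed on to `rs` is
-- thus a prefix of `r`, in order.
sweep : ∀ {α} ρ r rs → All (λ x → All (_≤ x) α) ρ → Sorted ρ → Below ρ r →
        ((α ++ r) ∷ rs) ⊳ ρ ≡ (α ++ ρ ++ drop (length ρ) r) ∷ (rs ⊳ take (length ρ) r)
sweep [] r rs _ _ _ = refl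
sweep {α} (x ∷ ρ) [] rs (α≤x ∷ α≤ρ) (x≤ρ ∷ sρ) _ = begin
  ((α ++ []) ∷ rs) ⊳ x ∷ ρ          ≡⟨ cong (_⊳ ρ) (insertion⇒≡ (stop (rowInsertion-past α≤x end))) ⟩
  ((α ++ x ∷ []) ∷ rs) ⊳ ρ          ≡⟨ cong (λ r → (r ∷ rs) ⊳ ρ) (++-identityʳ (α ++ x ∷ [])) ⟨
  (((α ++ x ∷ []) ++ []) ∷ rs) ⊳ ρ  ≡⟨ sweep ρ [] rs (All.zipWith (λ (p , q) → All.++⁺ p (q ∷ [])) (α≤ρ , x≤ρ)) sρ doneʳ ⟩
  ((α ++ x ∷ []) ++ ρ ++ drop (length ρ) []) ∷ (rs ⊳ take (length ρ) [])
    ≡⟨ cong₂ (λ d t → ((α ++ x ∷ []) ++ ρ ++ d) ∷ (rs ⊳ t)) (drop-[] (length ρ)) (take-[] (length ρ)) ⟩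
  ((α ++ x ∷ []) ++ ρ ++ []) ∷ rs   ≡⟨ cong (_∷ rs) (++-assoc α (x ∷ []) (ρ ++ [])) ⟩
  (α ++ x ∷ ρ ++ []) ∷ rs           ∎
  where
  open ≡-Reasoning
sweep {α} (x ∷ ρ) (y ∷ r) rs (α≤x ∷ α≤ρ) (x≤ρ ∷ sρ) (x<y ∷ b) = begin
  ((α ++ y ∷ r) ∷ rs) ⊳ x ∷ ρ
    ≡⟨ cong (_⊳ ρ) (insertion⇒≡ (next (rowInsertion-past α≤x (hit x<y)) (insertion y rs))) ⟩
  ((α ++ x ∷ r) ∷ insert y rs) ⊳ ρ
    ≡⟨ cong (λ s → (s ∷ insert y rs) ⊳ ρ) (++-assoc α (x ∷ []) r) ⟨
  (((α ++ x ∷ []) ++ r) ∷ insert y rs) ⊳ ρ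
    ≡⟨ sweep ρ r (insert y rs) (All.zipWith (λ (p , q) → All.++⁺ p (q ∷ [])) (α≤ρ , x≤ρ)) sρ b ⟩
  ((α ++ x ∷ []) ++ ρ ++ drop (length ρ) r) ∷ (insert y rs ⊳ take (length ρ) r)
    ≡⟨ cong (_∷ _) (++-assoc α (x ∷ []) _) ⟩
  (α ++ x ∷ ρ ++ drop (length ρ) r) ∷ (rs ⊳ take (length (x ∷ ρ)) (y ∷ r)) ∎
  where open ≡-Reasoning

append : ∀ r ρ rs → All (λ x → All (_≤ x) r) ρ → Sorted ρ → (r ∷ rs) ⊳ ρ ≡ (r ++ ρ) ∷ rs
append r ρ rs r≤ρ sρ = begin
  (r ∷ rs) ⊳ ρ          ≡⟨ cong (λ s → (s ∷ rs) ⊳ ρ) (++-identityʳ r) ⟨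
  ((r ++ []) ∷ rs) ⊳ ρ  ≡⟨ sweep ρ [] rs r≤ρ sρ doneʳ ⟩
  (r ++ ρ ++ drop (length ρ) []) ∷ (rs ⊳ take (length ρ) [])
    ≡⟨ cong₂ (λ d t → (r ++ ρ ++ d) ∷ (rs ⊳ t)) (drop-[] (length ρ)) (take-[] (length ρ)) ⟩
  (r ++ ρ ++ []) ∷ rs   ≡⟨ cong (λ s → (r ++ s) ∷ rs) (++-identityʳ ρ) ⟩
  (r ++ ρ) ∷ rs         ∎
  where
  open ≡-Reasoning

-- One pass of a bubble sort: the larger length stays and the smaller moves down. In a weakly
-- decreasing list this puts `m` in its place.
addRow : ℕ → List ℕ → List ℕ
addRow zero        ls       = ls
addRow (suc m)     []       = suc m ∷ []
addRow m@(suc _)   (l ∷ ls) = (m ⊔ l) ∷ addRow (m ⊓ l) ls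

length-overwrite : ∀ (ρ r : List ℕ) → length (ρ ++ drop (length ρ) r) ≡ length ρ ⊔ length r
length-overwrite []      r       = refl
length-overwrite (x ∷ ρ) []      = cong (suc ∘ length) (++-identityʳ ρ)
length-overwrite (x ∷ ρ) (y ∷ r) = cong suc (length-overwrite ρ r)

below-take : ∀ n {r s} → Over r s → Below (take n r) s
below-take zero    _         = doneˡ
below-take (suc n) []        = doneʳ
below-take (suc n) (x<y ∷ o) = x<y ∷ below-take n o

below-topRow : ∀ n {r rs} → Linked Over (r ∷ rs) → Below (take n r) (topRow rs)
below-topRow n [-]     = doneʳ
below-topRow n (o ∷ _) = below-take n o

semistandard-tail : ∀ {r rs} → Semistandard (r ∷ rs) → Semistandard rs
semistandard-tail (semistandard (_ ∷ ne) (_ ∷ ss) cs) = semistandard ne ss (Linked.tail cs)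

-- By `sweep`, the letters evicted from the first row form a prefix of it. This prefix is sorted
-- and, by column strictness, entrywise smaller than the second row, so the argument repeats there.
lengths-⊳-sorted : ∀ {T} ρ → Semistandard T → Sorted ρ → Below ρ (topRow T) →
                   map length (T ⊳ ρ) ≡ addRow (length ρ) (map length T)
lengths-⊳-sorted {T} [] _ _ _ = refl
lengths-⊳-sorted {[]} (x ∷ ρ) _ (x≤ρ ∷ sρ) _ =
  cong (map length) (append (x ∷ []) ρ [] (All.map (_∷ []) x≤ρ) sρ)
lengths-⊳-sorted {r ∷ rs} ρ@(_ ∷ _) ss@(semistandard _ (sr ∷ _) cs) sρ b = begin
  map length ((r ∷ rs) ⊳ ρ)
    ≡⟨ cong (map length) (sweep {[]} ρ r rs (All.universal (λ _ → []) ρ) sρ b) ⟩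
  length (ρ ++ drop (length ρ) r) ∷ map length (rs ⊳ take (length ρ) r)
    ≡⟨ cong₂ _∷_ (length-overwrite ρ r)
         (lengths-⊳-sorted (take (length ρ) r) (semistandard-tail ss) (AllPairs.take⁺ (length ρ) sr)
            (below-topRow (length ρ) cs)) ⟩
  (length ρ ⊔ length r) ∷ addRow (length (take (length ρ) r)) (map length rs)
    ≡⟨ cong (λ m → (length ρ ⊔ length r) ∷ addRow m (map length rs)) (length-take (length ρ) r) ⟩
  (length ρ ⊔ length r) ∷ addRow (length ρ ⊓ length r) (map length rs) ∎
  where open ≡-Reasoning

run : ℕ → ℕ → List ℕ
run a zero    = []
run a (suc k) = a ∷ run (suc a) k

length-run : ∀ a k → length (run a k) ≡ k
length-run a zero    = refl
length-run a (suc k) = cong suc (length-run (suc a) k)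

run-++ : ∀ a j k → run a (j + k) ≡ run a j ++ run (a + j) k
run-++ a zero    k = cong (λ i → run i k) (sym (+-identityʳ a))
run-++ a (suc j) k = cong (a ∷_) (trans (run-++ (suc a) j k)
                       (cong (λ i → run (suc a) j ++ run i k) (sym (+-suc a j))))

run-≥ : ∀ a k → All (a ≤_) (run a k)
run-≥ a zero    = []
run-≥ a (suc k) = ≤-refl ∷ All.map <⇒≤ (run-≥ (suc a) k)

run-< : ∀ a k → All (_< a + k) (run a k)
run-< a zero    = []
run-< a (suc k) = subst (λ n → All (_< n) (run a (suc k))) (sym (+-suc a k))
                    (s≤s (m≤m+n a k) ∷ run-< (suc a) k)

run-sorted : ∀ a k → Sorted (run a k)
run-sorted a zero    = []
run-sorted a (suc k) = All.map <⇒≤ (run-≥ (suc a) k) ∷ run-sorted (suc a) k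

insertionTableau-run : ∀ a k → insertionTableau (run a (suc k)) ≡ run a (suc k) ∷ []
insertionTableau-run a k =
  append (a ∷ []) (run (suc a) k) [] (All.map (λ p → <⇒≤ p ∷ []) (run-≥ (suc a) k)) (run-sorted (suc a) k)

-- Large letters in front of a word

module _ (N : ℕ) where

  -- The tableau of the word N, N+1, …, N+n-1 followed by a word with tableau T and entries below N:
  -- each growth of a row of T pushes the first of the large letters in that row one row down.
  fill : ℕ → Tableau → Tableau
  fill n       (r ∷ rs) = (r ++ run (N + length r) (n ∸ length r)) ∷ fill (n ⊓ length r) rs
  fill zero    []       = []
  fill (suc n) []       = run N (suc n) ∷ []

  rowInsertion-++-bump : ∀ {x r y r′} s → RowInsertion x r (just y) r′ →
                         RowInsertion x (r ++ s) (just y) (r′ ++ s)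
  rowInsertion-++-bump s (hit x<y)    = hit x<y
  rowInsertion-++-bump s (skip y≤x R) = skip y≤x (rowInsertion-++-bump s R)

  rowInsertion-++-end : ∀ {x r r′ z} s → x < z → RowInsertion x r nothing r′ →
                        RowInsertion x (r ++ z ∷ s) (just z) (r′ ++ s)
  rowInsertion-++-end s x<z end          = hit x<z
  rowInsertion-++-end s x<z (skip y≤x R) = skip y≤x (rowInsertion-++-end s x<z R)

  rowInsertion-large : ∀ {x r} → All (_≤ x) r → RowInsertion x r nothing (r ++ x ∷ [])
  rowInsertion-large []         = end
  rowInsertion-large (y≤x ∷ r≤) = skip y≤x (rowInsertion-large r≤)

  -- The letter `N + m` arriving from the row above exceeds every entry of the first row, so it is
  -- appended there.
  fill-grow : ∀ {T} m → AllEntries (_< N) T → length (topRow T) ≤ m →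
              Insertion (N + m) (fill m T) (fill (suc m) T)
  fill-grow {[]} zero _ _ = subst (λ n → Insertion n [] ((N ∷ []) ∷ [])) (sym (+-identityʳ N)) new
  fill-grow {[]} (suc m) _ _ =
    subst (λ r → Insertion (N + suc m) (run N (suc m) ∷ []) (r ∷ [])) eq
      (stop (rowInsertion-large (All.map <⇒≤ (run-< N (suc m)))))
    where
    eq : run N (suc m) ++ (N + suc m) ∷ [] ≡ run N (2 + m)
    eq = sym (trans (cong (run N) (+-comm 1 (suc m))) (run-++ N (suc m) 1))
  fill-grow {r ∷ rs} m (r<N ∷ _) l≤m
    rewrite m≥n⇒m⊓n≡n l≤m | m≥n⇒m⊓n≡n (m≤n⇒m≤1+n l≤m) =
    subst (λ s → Insertion (N + m) (row ∷ fill l rs) (s ∷ fill l rs)) eq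
      (stop (rowInsertion-large (All.++⁺ (All.map (λ p → ≤-trans (<⇒≤ p) (m≤m+n N m)) r<N)
        (All.map <⇒≤ (subst (λ n → All (_< n) (run (N + l) (m ∸ l))) N+m (run-< (N + l) (m ∸ l)))))))
    where
    l   = length r
    row = r ++ run (N + l) (m ∸ l)
    N+m : N + l + (m ∸ l) ≡ N + m
    N+m = trans (+-assoc N l (m ∸ l)) (cong (N +_) (m+[n∸m]≡n l≤m))
    eq : row ++ (N + m) ∷ [] ≡ r ++ run (N + l) (suc m ∸ l)
    eq = begin
      row ++ (N + m) ∷ []                           ≡⟨ ++-assoc r _ _ ⟩
      r ++ run (N + l) (m ∸ l) ++ (N + m) ∷ []      ≡⟨ cong (λ n → r ++ run (N + l) (m ∸ l) ++ n ∷ []) N+m ⟨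
      r ++ run (N + l) (m ∸ l) ++ run (N + l + (m ∸ l)) 1 ≡⟨ cong (r ++_) (run-++ (N + l) (m ∸ l) 1) ⟨
      r ++ run (N + l) (m ∸ l + 1)                  ≡⟨ cong (λ k → r ++ run (N + l) k) (trans (+-comm _ 1) (sym (+-∸-assoc 1 l≤m))) ⟩
      r ++ run (N + l) (suc m ∸ l)                  ∎
      where open ≡-Reasoning

  topRow-≤ : ∀ {r rs} → Linked Over (r ∷ rs) → length (topRow rs) ≤ length r
  topRow-≤ [-]     = z≤n
  topRow-≤ (o ∷ _) = over-length o

  fill-stop : ∀ {x r r′ rs} n → x < N → AllEntries (_< N) rs → Linked Over (r ∷ rs) →
              RowInsertion x r nothing r′ → Insertion x (fill n (r ∷ rs)) (fill n (r′ ∷ rs))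
  fill-stop {x} {r} {_} {rs} n x<N rs<N cs R
    with refl ← rowInsertion-append R
    rewrite trans (length-++ r {x ∷ []}) (+-comm (length r) 1)
    with <-≤-connex (length r) n
  -- The new letter takes the place of the first large letter of the row, `N + length r`, which
  -- moves into the next row.
  ... | inj₁ l<n
    rewrite m≥n⇒m⊓n≡n (<⇒≤ l<n) | m≥n⇒m⊓n≡n l<n | +-∸-assoc 1 l<n | +-suc N (length r) =
    next (rowInsertion-++-end _ (≤-trans x<N (m≤m+n N (length r))) R)
         (fill-grow (length r) rs<N (topRow-≤ cs))
  ... | inj₂ n≤l
    rewrite m≤n⇒m⊓n≡m n≤l | m≤n⇒m⊓n≡m (m≤n⇒m≤1+n n≤l) | m≤n⇒m∸n≡0 n≤l | m≤n⇒m∸n≡0 (m≤n⇒m≤1+n n≤l)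
          | ++-identityʳ r | ++-identityʳ (r ++ x ∷ []) = stop R

  fill-insertion : ∀ {x T T′} n → x < N → AllEntries (_< N) T → Linked Over T → Insertion x T T′ →
                   Insertion x (fill n T) (fill n T′)
  fill-insertion zero    x<N _ _ new = new
  fill-insertion (suc n) x<N _ _ new rewrite ⊓-zeroʳ n | +-comm N 1 = next (hit x<N) new
  fill-insertion n x<N (_ ∷ rs<N) cs (stop R) = fill-stop n x<N rs<N cs R
  -- Bumping keeps the length of the row, so its large letters stay put.
  fill-insertion n x<N (r<N ∷ rs<N) cs (next R I) rewrite rowInsertion-length R =
    next (rowInsertion-++-bump _ R) (fill-insertion _ (bumped-P r<N R) rs<N (Linked.tail cs) I)

  fill-⊳ : ∀ {T} n w → All (_< N) w → AllEntries (_< N) T → Linked Over T →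
           fill n T ⊳ w ≡ fill n (T ⊳ w)
  fill-⊳ n [] _ _ _ = refl
  fill-⊳ {T} n (x ∷ w) (x<N ∷ w<N) T<N cs =
    trans (cong (_⊳ w) (insertion⇒≡ (fill-insertion n x<N T<N cs I)))
          (fill-⊳ n w w<N (insertion-All x<N T<N I) (insertion-columns cs I))
    where I = insertion x T

  insertionTableau-fill : ∀ n w → All (_< N) w →
                          insertionTableau (run N n ++ w) ≡ fill n (insertionTableau w)
  insertionTableau-fill n w w<N = trans (⊳-++ [] (run N n) w)
    (trans (cong (_⊳ w) (base n)) (fill-⊳ n w w<N [] []))
    where
    base : ∀ n → insertionTableau (run N n) ≡ fill n []
    base zero    = refl
    base (suc n) = insertionTableau-run N n

  length-pad : ∀ (r : List ℕ) a k → length (r ++ run a k) ≡ length r + k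
  length-pad r a k = trans (length-++ r) (cong (length r +_) (length-run a k))

  -- Each row is padded to the length of the row above it, the first to `n`, and a row of large
  -- letters only is added at the bottom. The old lengths thus move down by one row.
  lengths-fill : ∀ {T} n → Semistandard T → 0 < n → length (topRow T) ≤ n →
                 map length (fill n T) ≡ n ∷ map length T
  lengths-fill {[]} (suc n) _ _ _ = cong (λ l → suc l ∷ []) (length-run (suc N) n)
  lengths-fill {r ∷ rs} n ss@(semistandard (r>0 ∷ _) _ cs) _ l≤n = cong₂ _∷_
    (trans (length-pad r (N + length r) (n ∸ length r)) (m+[n∸m]≡n l≤n))
    (trans (cong (λ m → map length (fill m rs)) (m≥n⇒m⊓n≡n l≤n))
           (lengths-fill (length r) (semistandard-tail ss) r>0 (topRow-≤ cs)))

-- Shapes padded with zeros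

trim : List ℕ → List ℕ
trim []           = []
trim (zero ∷ ls)  = trim ls
trim (suc l ∷ ls) = suc l ∷ trim ls

WeaklyDecreasing : List ℕ → Set
WeaklyDecreasing = Linked _≥_

addRow-top : ∀ {z ls} → WeaklyDecreasing (z ∷ ls) → addRow z (trim ls) ≡ trim (z ∷ ls)
addRow-top {zero} _ = refl
addRow-top {suc z} [-] = refl
addRow-top {suc z} {zero ∷ ls} (_ ∷ [-]) = refl
addRow-top {suc z} {zero ∷ l ∷ ls} (_ ∷ z≥l ∷ d) = addRow-top {suc z} {l ∷ ls} (≤-trans z≥l z≤n ∷ d)
addRow-top {suc z} {suc l ∷ ls} (z≥l ∷ d) = cong₂ _∷_ (m≥n⇒m⊔n≡m z≥l)
  (trans (cong (λ m → addRow m (trim ls)) (m≥n⇒m⊓n≡n z≥l)) (addRow-top d))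

WeaklyDecreasing⇒≥ : ∀ {z} α {β} → WeaklyDecreasing (α ++ z ∷ β) → All (_≥ z) α
WeaklyDecreasing⇒≥ []      _  = []
WeaklyDecreasing⇒≥ (x ∷ α) d with a ∷ _ ← Linked.Linked⇒AllPairs (λ p q → ≤-trans q p) d =
  All.head (All.++⁻ʳ α a) ∷ WeaklyDecreasing⇒≥ α (Linked.tail d)

-- The rows in `α` are at least `z` and let it pass; from there on, each length takes the place of
-- the next (`addRow-top`).
addRow-++ : ∀ {z} α {β} → WeaklyDecreasing (α ++ z ∷ β) → addRow z (trim (α ++ β)) ≡ trim (α ++ z ∷ β)
addRow-++ α d = go α (WeaklyDecreasing⇒≥ α d) d
  where
  go : ∀ {z} α {β} → All (_≥ z) α → WeaklyDecreasing (α ++ z ∷ β) →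
       addRow z (trim (α ++ β)) ≡ trim (α ++ z ∷ β)
  go []                       _         d = addRow-top d
  go {zero}  (zero ∷ α)       (_ ∷ ps)  d = go α ps (Linked.tail d)
  go {zero}  (suc x ∷ α)      (_ ∷ ps)  d = cong (suc x ∷_) (go α ps (Linked.tail d))
  go {suc z} (suc x ∷ α) {β}  (p ∷ ps)  d = cong₂ _∷_ (m≤n⇒m⊔n≡n p)
    (trans (cong (λ m → addRow m (trim (α ++ β))) (m≤n⇒m⊓n≡m p)) (go α ps (Linked.tail d)))

-- The shape of a wrapped word

prependToTop : ℕ → Tableau → Tableau
prependToTop c []       = (c ∷ []) ∷ []
prependToTop c (r ∷ rs) = (c ∷ r) ∷ rs

-- A corner letter not exceeding the inserted one is skipped, so the rest of the tableau develops as
-- if it were absent.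
prependToTop-insertion : ∀ {c x T T′} → c ≤ x → Insertion x T T′ →
                         Insertion x (prependToTop c T) (prependToTop c T′)
prependToTop-insertion c≤x new        = stop (skip c≤x end)
prependToTop-insertion c≤x (stop R)   = stop (skip c≤x R)
prependToTop-insertion c≤x (next R I) = next (skip c≤x R) I

prependToTop-⊳ : ∀ {c T} w → All (c ≤_) w → prependToTop c T ⊳ w ≡ prependToTop c (T ⊳ w)
prependToTop-⊳ [] [] = refl
prependToTop-⊳ {c} {T} (x ∷ w) (c≤x ∷ c≤w) =
  trans (cong (_⊳ w) (insertion⇒≡ (prependToTop-insertion c≤x (insertion x T)))) (prependToTop-⊳ w c≤w)

below-threshold : ∀ {c ρ r} → All (_< c) ρ → All (c ≤_) r → Below ρ r
below-threshold []        _         = doneˡ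
below-threshold (_ ∷ _)   []        = doneʳ
below-threshold (p ∷ ρ<c) (q ∷ c≤r) = <-≤-trans p q ∷ below-threshold ρ<c c≤r

take-length-++ : ∀ {n} (xs ys : List ℕ) → length xs ≡ n → take n (xs ++ ys) ≡ xs
take-length-++ []       ys refl = refl
take-length-++ (x ∷ xs) ys refl = cong (x ∷_) (take-length-++ xs ys refl)

drop-length-++ : ∀ {n} (xs ys : List ℕ) → length xs ≡ n → drop n (xs ++ ys) ≡ ys
drop-length-++ []       ys refl = refl
drop-length-++ (x ∷ xs) ys refl = drop-length-++ xs ys refl

all-≤ : ∀ {c} {xs ys : List ℕ} → All (_≤ c) xs → All (c ≤_) ys → All (λ y → All (_≤ y) xs) ys
all-≤ xs≤c = All.map (λ c≤y → All.map (λ x≤c → ≤-trans x≤c c≤y) xs≤c)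

-- The first row of the empty tableau is taken to be empty.
record TopSplit (T : Tableau) (l : ℕ) (ls : List ℕ) : Set₁ where
  field
    top     : List ℕ
    rest    : Tableau
    eq      : ∀ {c} → prependToTop c T ≡ (c ∷ top) ∷ rest
    length≡ : length top ≡ l
    shape≡  : map length rest ≡ trim ls
    sorted  : Sorted top
    all-top : ∀ {P : ℕ → Set} → AllEntries P T → All P top
    all-rest : ∀ {P : ℕ → Set} → AllEntries P T → AllEntries P rest
    over    : Linked Over (top ∷ rest)
    rest-semistandard : Semistandard rest

trim≡[] : ∀ {l ls} → WeaklyDecreasing (l ∷ ls) → [] ≡ trim (l ∷ ls) → (l ≡ 0) × ([] ≡ trim ls)
trim≡[] {zero} _ e = refl , e

trim-zeros : ∀ {ls} → WeaklyDecreasing (0 ∷ ls) → trim ls ≡ []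
trim-zeros [-]       = refl
trim-zeros (z≤n ∷ d) = trim-zeros d

trim≡∷ : ∀ {l ls m ms} → WeaklyDecreasing (l ∷ ls) → 0 < m → m ∷ ms ≡ trim (l ∷ ls) → (m ≡ l) × (ms ≡ trim ls)
trim≡∷ {suc l} _ _ refl = refl , refl
trim≡∷ {zero} d m>0 e with () ← trans e (trim-zeros d)

topSplit : ∀ {T l ls} → Semistandard T → WeaklyDecreasing (l ∷ ls) → map length T ≡ trim (l ∷ ls) →
           TopSplit T l ls
topSplit {[]} _ d e with refl , e′ ← trim≡[] d e = record
  { top = [] ; rest = [] ; eq = refl ; length≡ = refl ; shape≡ = e′ ; sorted = []
  ; all-top = λ _ → [] ; all-rest = λ _ → [] ; over = [-]
  ; rest-semistandard = semistandard [] [] [] }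
topSplit {r ∷ rs} ss@(semistandard (r>0 ∷ _) (sr ∷ _) cs) d e with refl , e′ ← trim≡∷ d r>0 e = record
  { top = r ; rest = rs ; eq = refl ; length≡ = refl ; shape≡ = e′ ; sorted = sr
  ; all-top = All.head ; all-rest = All.tail ; over = cs
  ; rest-semistandard = semistandard-tail ss }

below-++ : ∀ {N ρ r} s → Over ρ r → All (_< N) ρ → All (N ≤_) s → Below ρ (r ++ s)
below-++ s []        ρ<N       N≤s = below-threshold ρ<N N≤s
below-++ s (p ∷ o)   (_ ∷ ρ<N) N≤s = p ∷ below-++ s o ρ<N N≤s

-- Against an entry of `T` column strictness applies; against the padding, every letter of `ρ` is
-- below `N`.
below-fill : ∀ {N ρ T} n → Linked Over (ρ ∷ T) → All (_< N) ρ → Below ρ (topRow (fill N (suc n) T))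
below-fill {N} n [-] ρ<N = below-threshold ρ<N (run-≥ N (suc n))
below-fill {N} n (_∷_ {y = r} o _) ρ<N =
  below-++ _ o ρ<N (All.map (≤-trans (m≤m+n N (length r))) (run-≥ (N + length r) (suc n ∸ length r)))

addRow-shorter : ∀ {l p ls} → WeaklyDecreasing (l ∷ ls) → l ≤ suc p →
                 addRow l (suc p ∷ trim ls) ≡ suc p ∷ trim (l ∷ ls)
addRow-shorter {zero} _ _ = refl
addRow-shorter {suc l} {ls = ls} d l≤p = cong₂ _∷_ (m≤n⇒m⊔n≡n l≤p)
  (trans (cong (λ m → addRow m (trim ls)) (m≤n⇒m⊓n≡m l≤p)) (addRow-top d))

-- With the run from N to N+p in front of t and a single 0 before it, the first row of t is the
-- part of the top row that the final run 1,…,a pushes into the second row.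
wrap : (N p b a : ℕ) → List ℕ → List ℕ
wrap N p b a t = run N (suc p) ++ 0 ∷ t ++ run (N + suc p) b ++ run 1 a

lengths-append : ∀ {l ls T} ρ → map length T ≡ l ∷ ls → (∀ {r} → r ≡ topRow T → All (λ x → All (_≤ x) r) ρ) →
                 Sorted ρ → map length (T ⊳ ρ) ≡ (l + length ρ) ∷ ls
lengths-append {T = r ∷ rs} ρ refl r≤ρ sρ =
  trans (cong (map length) (append r ρ rs (r≤ρ refl) sρ)) (cong (_∷ map length rs) (length-++ r))

-- The final run 1, ..., `l + c` evicts the first row `top` of `t` and the first `c` letters of the
-- run from `M`; `d` letters of that run remain. In the rows `S` below, `top` adds a row of length
-- `l`, and the `c` evicted large letters then lengthen the first of these rows.
shape-wrap : ∀ {N p l ls} c d t → suc (l + c) ≤ N → All (suc (l + c) ≤_) t → All (_< N) t →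
             WeaklyDecreasing (l ∷ ls) → shape t ≡ trim (l ∷ ls) → p ≤ l → l ≤ suc p →
             shape (wrap N p (c + d) (l + c) t) ≡ suc (l + c + d) ∷ suc (p + c) ∷ trim (l ∷ ls)
shape-wrap {N} {p} {l} {ls} c d t a<N a<t t<N dec sh p≤l l≤1+p = begin
  shape (wrap N p (c + d) a t)
    ≡⟨ cong (map length) tableau ⟩
  length (0 ∷ run 1 a ++ run (M + c) d) ∷ map length (S ⊳ top ++ run M c)
    ≡⟨ cong₂ (λ m ms → suc m ∷ ms)
         (trans (length-pad 0 (run 1 a) (M + c) d) (cong (_+ d) (length-run 1 a)))
         (trans (cong (map length) (⊳-++ S top (run M c)))
           (trans (lengths-append (run M c) lengths-S⊳top (λ { refl → all-≤ top<M (run-≥ M c) }) (run-sorted M c))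
                  (cong (λ k → suc (p + k) ∷ trim (l ∷ ls)) (length-run M c)))) ⟩
  suc (a + d) ∷ suc (p + c) ∷ trim (l ∷ ls) ∎
  where
  open ≡-Reasoning
  a = l + c
  M = N + suc p
  open TopSplit (topSplit (insertionTableau-semistandard t) dec sh)

  S = fill N (suc p) rest

  0t<N : All (_< N) (0 ∷ t)
  0t<N = ≤-trans (s≤s z≤n) a<N ∷ t<N

  entries-t : ∀ {P : ℕ → Set} → All P t → AllEntries P (insertionTableau t)
  entries-t pt = ⊳-All t pt []

  prefix : insertionTableau (run N (suc p) ++ 0 ∷ t) ≡ (0 ∷ top) ∷ S
  prefix = begin
    insertionTableau (run N (suc p) ++ 0 ∷ t)
      ≡⟨ insertionTableau-fill N (suc p) (0 ∷ t) 0t<N ⟩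
    fill N (suc p) (prependToTop 0 [] ⊳ t)
      ≡⟨ cong (fill N (suc p)) (prependToTop-⊳ t (All.universal (λ _ → z≤n) t)) ⟩
    fill N (suc p) (prependToTop 0 (insertionTableau t))
      ≡⟨ cong (fill N (suc p)) eq ⟩
    (0 ∷ top ++ run (N + suc (length top)) (p ∸ length top)) ∷ fill N (suc (p ⊓ length top)) rest
      -- The corner 0 brings the first row to length `l + 1`, at least `p + 1`, so all the letters
      -- `N`, ..., `N + p` have left it.
      ≡⟨ cong₂ (λ k m → (0 ∷ top ++ run (N + suc (length top)) k) ∷ fill N (suc m) rest)
           (m≤n⇒m∸n≡0 p≤top) (m≤n⇒m⊓n≡m p≤top) ⟩
    (0 ∷ top ++ []) ∷ S
      ≡⟨ cong (λ r → (0 ∷ r) ∷ S) (++-identityʳ top) ⟩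
    (0 ∷ top) ∷ S ∎
    where p≤top = subst (p ≤_) (sym length≡) p≤l

  semistandard-S : Semistandard S
  semistandard-S = semistandard-tail (subst Semistandard prefix (insertionTableau-semistandard (run N (suc p) ++ 0 ∷ t)))

  entries-S : AllEntries (_< M) S
  entries-S = All.tail (subst (AllEntries (_< M)) prefix (⊳-All (run N (suc p) ++ 0 ∷ t)
    (All.++⁺ (run-< N (suc p)) (All.map (λ q → ≤-trans q (m≤m+n N (suc p))) 0t<N)) []))

  top<N : All (_< N) top
  top<N = all-top (entries-t t<N)

  top<M : All (_≤ M) (topRow (S ⊳ top))
  top<M = go (⊳-All top (All.map (λ q → ≤-trans q (m≤m+n N (suc p))) top<N) entries-S)
    where
    go : ∀ {T} → AllEntries (_< M) T → All (_≤ M) (topRow T)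
    go []      = []
    go (q ∷ _) = All.map <⇒≤ q

  tableau : insertionTableau (wrap N p (c + d) a t) ≡
            (0 ∷ run 1 a ++ run (M + c) d) ∷ (S ⊳ top ++ run M c)
  tableau = begin
    insertionTableau (wrap N p (c + d) a t)
      ≡⟨ cong insertionTableau (++-assoc (run N (suc p)) (0 ∷ t) (run M (c + d) ++ run 1 a)) ⟨
    insertionTableau ((run N (suc p) ++ 0 ∷ t) ++ run M (c + d) ++ run 1 a)
      ≡⟨ ⊳-++ [] (run N (suc p) ++ 0 ∷ t) _ ⟩
    insertionTableau (run N (suc p) ++ 0 ∷ t) ⊳ run M (c + d) ++ run 1 a
      ≡⟨ cong (_⊳ run M (c + d) ++ run 1 a) prefix ⟩
    ((0 ∷ top) ∷ S) ⊳ run M (c + d) ++ run 1 a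
      ≡⟨ ⊳-++ _ (run M (c + d)) (run 1 a) ⟩
    ((0 ∷ top) ∷ S) ⊳ run M (c + d) ⊳ run 1 a
      ≡⟨ cong (_⊳ run 1 a) (append (0 ∷ top) (run M (c + d)) S
           (all-≤ (z≤n ∷ All.map (λ q → ≤-trans (<⇒≤ q) (m≤m+n N (suc p))) top<N) (run-≥ M (c + d))) (run-sorted M (c + d))) ⟩
    ((0 ∷ top ++ run M (c + d)) ∷ S) ⊳ run 1 a
      ≡⟨ cong (λ r → ((0 ∷ r) ∷ S) ⊳ run 1 a)
           (trans (cong (top ++_) (run-++ M c d)) (sym (++-assoc top (run M c) (run (M + c) d)))) ⟩
    ((0 ∷ (top ++ run M c) ++ run (M + c) d) ∷ S) ⊳ run 1 a
      -- Only the corner 0 is smaller than the run 1, ..., `a`; all other letters of the row are at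
      -- least `a + 1`.
      ≡⟨ sweep {0 ∷ []} (run 1 a) ((top ++ run M c) ++ run (M + c) d) S
           (All.universal (λ _ → z≤n ∷ []) _) (run-sorted 1 a)
           (below-threshold (run-< 1 a) (All.++⁺ (All.++⁺ (all-top (entries-t a<t)) (≤M (run-≥ M c)))
             (≤M (All.map (≤-trans (m≤m+n M c)) (run-≥ (M + c) d))))) ⟩
    (0 ∷ run 1 a ++ drop (length (run 1 a)) ((top ++ run M c) ++ run (M + c) d)) ∷
      (S ⊳ take (length (run 1 a)) ((top ++ run M c) ++ run (M + c) d))
      ≡⟨ cong₂ (λ r w → (0 ∷ run 1 a ++ r) ∷ (S ⊳ w)) (drop-length-++ (top ++ run M c) _ length-a) (take-length-++ (top ++ run M c) _ length-a) ⟩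
    (0 ∷ run 1 a ++ run (M + c) d) ∷ (S ⊳ top ++ run M c) ∎
    where
    length-a : length (top ++ run M c) ≡ length (run 1 a)
    length-a = trans (length-pad 0 top M c) (trans (cong (_+ c) length≡) (sym (length-run 1 a)))
    ≤M : ∀ {xs} → All (M ≤_) xs → All (suc a ≤_) xs
    ≤M = All.map (≤-trans (≤-trans a<N (m≤m+n N (suc p))))

  -- The first row of `S` has length `p + 1`; the new row of length `l` comes second because
  -- `l ≤ suc p`.
  lengths-S⊳top : map length (S ⊳ top) ≡ suc p ∷ trim (l ∷ ls)
  lengths-S⊳top = begin
    map length (S ⊳ top)
      ≡⟨ lengths-⊳-sorted top semistandard-S sorted (below-fill p over top<N) ⟩
    addRow (length top) (map length S)
      ≡⟨ cong₂ addRow length≡ (trans (lengths-fill N (suc p) rest-semistandard (s≤s z≤n)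
             (≤-trans (topRow-≤ N over) (≤-trans (≤-reflexive length≡) l≤1+p))) (cong (suc p ∷_) shape≡)) ⟩
    addRow l (suc p ∷ trim ls)
      ≡⟨ addRow-shorter dec l≤1+p ⟩
    suc p ∷ trim (l ∷ ls) ∎

-- Words realising pairs of shapes

map-run : ∀ k a n → map (k +_) (run a n) ≡ run (k + a) n
map-run k a zero    = refl
map-run k a (suc n) = cong₂ _∷_ refl (trans (map-run k (suc a) n) (cong (λ i → run i n) (+-suc k a)))

shape-shift : ∀ k w → shape (map (k +_) w) ≡ shape w
shape-shift k w = shape-map {P = λ _ → ⊤} (λ _ _ → mk⇔ (+-monoʳ-< k) (+-cancelˡ-< k _ _)) w
                    (All.universal (λ _ → tt) w)

-- The lists μ and ν may end in zeros.
record Realised (μ ν : List ℕ) : Set where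
  field
    size        : ℕ
    big small   : List ℕ
    permutation : big ↭ run 0 size
    sublist     : small ⊆ big
    shape-big   : shape big ≡ trim μ
    shape-small : shape small ≡ trim ν

  big-< : All (_< size) big
  big-< = All-resp-↭ (↭-sym permutation) (run-< 0 size)

  small-< : All (_< size) small
  small-< = Sub.All-resp-⊆ sublist big-<

shift-permutation : ∀ {w n} k → w ↭ run 0 n → map (k +_) w ↭ run k n
shift-permutation {n = n} k p =
  ↭-trans (Perm.map⁺ (k +_) p) (↭-reflexive (trans (map-run k 0 n) (cong (λ i → run i n) (+-identityʳ k))))

-- This handles the last entry +1 of `μ - ν`: an increasing word loses its final letter.
realised-single : ∀ m → Realised (suc m ∷ []) (m ∷ [])
realised-single m = record
  { size        = suc m
  ; big         = run 0 (suc m)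
  ; small       = run 0 m
  ; permutation = ↭-refl
  ; sublist     = subst (run 0 m ⊆_) (trans (sym (run-++ 0 m 1)) (cong (run 0) (+-comm m 1)))
                    (Sub.++⁺ʳ (m ∷ []) ⊆-refl)
  ; shape-big   = shape-run (suc m)
  ; shape-small = shape-run m
  }
  where
  shape-run : ∀ k → shape (run 0 k) ≡ trim (k ∷ [])
  shape-run zero    = refl
  shape-run (suc k) = trans (cong (map length) (insertionTableau-run 0 k))
                            (cong (λ n → suc n ∷ []) (length-run 1 k))

-- Appending z increasing letters below all others adds a row of length z to the shape.
realised-addRow : ∀ {z} α {β} α′ {β′} → WeaklyDecreasing (α ++ z ∷ β) → WeaklyDecreasing (α′ ++ z ∷ β′) →
                  Realised (α ++ β) (α′ ++ β′) → Realised (α ++ z ∷ β) (α′ ++ z ∷ β′)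
realised-addRow {z} α α′ d d′ R = record
  { size        = z + size
  ; big         = map (z +_) big ++ run 0 z
  ; small       = map (z +_) small ++ run 0 z
  ; permutation = ↭-trans (++-comm (map (z +_) big) (run 0 z))
                    (↭-trans (Perm.++⁺ˡ (run 0 z) (shift-permutation z permutation))
                             (↭-reflexive (sym (run-++ 0 z size))))
  ; sublist     = Sub.++⁺ (Sub.map⁺ (z +_) sublist) ⊆-refl
  ; shape-big   = trans (shape-add big) (trans (cong (addRow z) shape-big) (addRow-++ α d))
  ; shape-small = trans (shape-add small) (trans (cong (addRow z) shape-small) (addRow-++ α′ d′))
  }
  where
  open Realised R
  shape-add : ∀ w → shape (map (z +_) w ++ run 0 z) ≡ addRow z (shape w)
  shape-add w = begin
    shape (map (z +_) w ++ run 0 z)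
      ≡⟨ cong (map length) (⊳-++ [] (map (z +_) w) (run 0 z)) ⟩
    map length (insertionTableau (map (z +_) w) ⊳ run 0 z)
      ≡⟨ lengths-⊳-sorted (run 0 z) (insertionTableau-semistandard (map (z +_) w)) (run-sorted 0 z)
           (below-threshold (run-< 0 z) (top (⊳-All (map (z +_) w) (All.map⁺ (All.universal (m≤m+n z) w)) []))) ⟩
    addRow (length (run 0 z)) (shape (map (z +_) w))
      ≡⟨ cong₂ addRow (length-run 0 z) (shape-shift z w) ⟩
    addRow z (shape w) ∎
    where
    open ≡-Reasoning
    top : ∀ {T} → AllEntries (z ≤_) T → All (z ≤_) (topRow T)
    top []      = []
    top (q ∷ _) = q

wrap-permutation : ∀ {n t} a b p → t ↭ run (suc a) n →
                   wrap (suc a + n) p b a t ↭ run 0 (suc a + n + (suc p + b))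
wrap-permutation {n} {t} a b p π = begin
  X ++ 0 ∷ t ++ Z ++ V       ↭⟨ Perm.++⁺ˡ X (↭-prep 0 (↭-trans (↭-reflexive (sym (++-assoc t Z V))) (++-comm (t ++ Z) V))) ⟩
  X ++ 0 ∷ V ++ t ++ Z       ↭⟨ Perm.++⁺ˡ X (↭-prep 0 (Perm.++⁺ˡ V (Perm.++⁺ʳ Z π))) ⟩
  X ++ 0 ∷ V ++ U ++ Z       ≡⟨ cong (λ w → X ++ 0 ∷ w) (++-assoc V U Z) ⟨
  X ++ (0 ∷ V ++ U) ++ Z     ↭⟨ shifts X (0 ∷ V ++ U) ⟩
  (0 ∷ V ++ U) ++ X ++ Z     ≡⟨ cong₂ (λ v w → 0 ∷ v ++ w) (run-++ 1 a n) (run-++ N (suc p) b) ⟨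
  0 ∷ run 1 (a + n) ++ run N (suc p + b) ≡⟨ run-++ 0 N (suc p + b) ⟨
  run 0 (N + (suc p + b))    ∎
  where
  open PermutationReasoning
  N = suc a + n
  X = run N (suc p)
  Z = run (N + suc p) b
  V = run 1 a
  U = run (suc a) n

-- Both words get the same wrapping. The first row of `small` is one shorter than that of `big`, so
-- the final run evicts one more large letter: the new first row loses a box and the second gains
-- one.
realised-wrap : ∀ {m l p μ ν} → WeaklyDecreasing (suc m ∷ l ∷ suc p ∷ μ) → WeaklyDecreasing (m ∷ suc l ∷ p ∷ ν) →
                Realised (suc p ∷ μ) (p ∷ ν) → Realised (suc m ∷ l ∷ suc p ∷ μ) (m ∷ suc l ∷ p ∷ ν)
realised-wrap {μ = μ} {ν} (_ ∷ l>p ∷ d) (m>l ∷ _ ∷ d′) R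
  -- The gaps `l = p + 1 + c` and `m = l + 1 + e` determine the wrapping: `a = l` and
  -- `b = c + 1 + e`.
  with c , refl ← m≤n⇒∃[o]m+o≡n l>p | e , refl ← m≤n⇒∃[o]m+o≡n m>l = record
  { size        = N + (suc p + b)
  ; big         = wrap N p b a (shifted big)
  ; small       = wrap N p b a (shifted small)
  ; permutation = wrap-permutation a b p (shift-permutation (suc a) permutation)
  ; sublist     = Sub.++⁺ (⊆-refl {x = run N (suc p)}) (refl ∷ Sub.++⁺ (Sub.map⁺ (suc a +_) sublist) ⊆-refl)
  ; shape-big   = trans
      (shape-wrap c (suc e) (shifted big) (m≤m+n (suc a) size) (shifted-≥ big) (shifted-< big-<) d
        (trans (shape-shift (suc a) big) shape-big) (n≤1+n p) ≤-refl)
      (cong (λ k → k ∷ suc (p + c) ∷ suc p ∷ trim μ) (cong suc (+-suc (suc p + c) e)))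
  ; shape-small = trans
      (cong₂ (λ k i → shape (wrap N p k i (shifted small))) (+-suc c e) (sym (+-suc p c)))
      (trans
        (shape-wrap (suc c) e (shifted small)
          (subst (λ i → suc i ≤ N) (sym (+-suc p c)) (m≤m+n (suc a) size))
          (subst (λ i → All (suc i ≤_) (shifted small)) (sym (+-suc p c)) (shifted-≥ small))
          (shifted-< small-<) d′
          (trans (shape-shift (suc a) small) shape-small) ≤-refl (n≤1+n p))
        (cong₂ (λ k i → suc (k + e) ∷ suc i ∷ trim (p ∷ ν)) (+-suc p c) (+-suc p c)))
  }
  where
  open Realised R
  p = _
  a = suc p + c
  b = c + suc e
  N = suc a + size
  shifted : List ℕ → List ℕ
  shifted = map (suc a +_)
  shifted-≥ : ∀ w → All (suc a ≤_) (shifted w)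
  shifted-≥ w = All.map⁺ (All.universal (m≤m+n (suc a)) w)
  shifted-< : ∀ {w} → All (_< size) w → All (_< N) (shifted w)
  shifted-< = All.map⁺ ∘ All.map (+-monoʳ-< (suc a))

-- The nonzero entries of μ - ν alternate between +1 and -1 and end in +1; they begin with +1 if
-- the flag is false, and continue after a +1 if it is true.
data Alternating : Bool → List ℕ → List ℕ → Set where
  nil   : Alternating true [] []
  equal : ∀ {s μ ν} z → Alternating s μ ν → Alternating s (z ∷ μ) (z ∷ ν)
  plus  : ∀ {μ ν} m → Alternating true μ ν → Alternating false (suc m ∷ μ) (m ∷ ν)
  minus : ∀ {μ ν} m → Alternating false μ ν → Alternating true (m ∷ μ) (suc m ∷ ν)

delete₂ : ∀ {x y} {ls} → WeaklyDecreasing (x ∷ y ∷ ls) → WeaklyDecreasing (x ∷ ls)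
delete₂ (_ ∷ [-])          = [-]
delete₂ (x≥y ∷ y≥z ∷ d) = ≤-trans y≥z x≥y ∷ d

delete₃ : ∀ {x y z} {ls} → WeaklyDecreasing (x ∷ y ∷ z ∷ ls) → WeaklyDecreasing (x ∷ y ∷ ls)
delete₃ (x≥y ∷ d) = x≥y ∷ delete₂ d

mutual
  -- The superscripts record the signs of the rows still waiting. Rows on which the lists agree are
  -- inserted just after these, hence the lists `α` and `α′` in `realised-addRow`. A waiting pair
  -- +1, -1 is wrapped around the rest once that begins with +1.
  realise : ∀ {μ ν} → Alternating false μ ν → WeaklyDecreasing μ → WeaklyDecreasing ν → Realised μ ν
  realise (equal z A) d d′ = realised-addRow [] [] d d′ (realise A (Linked.tail d) (Linked.tail d′))
  realise (plus m A)  d d′ = realise⁺ m A d d′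

  realise⁺ : ∀ {μ ν} m → Alternating true μ ν → WeaklyDecreasing (suc m ∷ μ) → WeaklyDecreasing (m ∷ ν) →
             Realised (suc m ∷ μ) (m ∷ ν)
  realise⁺ m nil         d d′ = realised-single m
  realise⁺ m (equal z A) d d′ =
    realised-addRow (suc m ∷ []) (m ∷ []) d d′ (realise⁺ m A (delete₂ d) (delete₂ d′))
  realise⁺ m (minus l A) d d′ = realise⁺⁻ m l A d d′

  realise⁺⁻ : ∀ {μ ν} m l → Alternating false μ ν →
              WeaklyDecreasing (suc m ∷ l ∷ μ) → WeaklyDecreasing (m ∷ suc l ∷ ν) →
              Realised (suc m ∷ l ∷ μ) (m ∷ suc l ∷ ν)
  realise⁺⁻ m l (equal z A) d d′ =
    realised-addRow (suc m ∷ l ∷ []) (m ∷ suc l ∷ []) d d′ (realise⁺⁻ m l A (delete₃ d) (delete₃ d′))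
  realise⁺⁻ m l (plus p A) d d′ =
    realised-wrap d d′ (realise⁺ p A (Linked.tail (Linked.tail d)) (Linked.tail (Linked.tail d′)))

-- Interpolation in the double domination order

-- For weakly decreasing lists with sum μ = sum λ + s this is the double domination order: the lower
-- bounds on the suffix sums of μ express λ* ⊴ μ*, the upper bounds express λ ⊴ μ.
data Dominated (s : ℕ) : List ℕ → List ℕ → Set where
  []   : Dominated s [] []
  step : ∀ {l m λ′ μ} → sum (l ∷ λ′) ≤ sum (m ∷ μ) → sum (m ∷ μ) ≤ sum (l ∷ λ′) + s →
         Dominated s λ′ μ → Dominated s (l ∷ λ′) (m ∷ μ)

dominated-0 : ∀ {λ′ μ} → Dominated 0 λ′ μ → λ′ ≡ μ
dominated-0 [] = refl
dominated-0 {l ∷ λ′} (step p q D) with refl ← dominated-0 D =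
  cong (_∷ λ′) (+-cancelʳ-≡ (sum λ′) _ _ (≤-antisym p (≤-trans q (≤-reflexive (+-identityʳ _)))))

-- With flag `true` the first entry of an interpolant may exceed that of `μ`, but not that of `λ′`;
-- with flag `false` it does not exceed that of `μ`.
bound : Bool → List ℕ → List ℕ → List ℕ
bound true  λ′ μ = λ′
bound false λ′ μ = μ

deficit : Bool → ℕ
deficit true  = 0
deficit false = 1

-- `extends` carries both the monotonicity of `between` and the bound on its first entry, in the
-- form needed to add a row on top.
record Interpolant (b : Bool) (s : ℕ) (λ′ μ : List ℕ) : Set where
  field
    between     : List ℕ
    alternating : Alternating b μ between
    dominated   : Dominated s λ′ between
    sum≡        : sum μ ≡ deficit b + sum between
    extends     : ∀ {x} → WeaklyDecreasing (x ∷ bound b λ′ μ) → WeaklyDecreasing (x ∷ between)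

-- A box is removed from the row at which the suffix sums of λ and μ cease to agree (read upwards),
-- and added to the row at which they begin to agree again.
interpolate : ∀ {s λ′ μ} → Dominated (suc s) λ′ μ → WeaklyDecreasing λ′ → WeaklyDecreasing μ →
              (sum λ′ ≡ sum μ × Interpolant true s λ′ μ) ⊎ (sum λ′ < sum μ × Interpolant false s λ′ μ)
interpolate [] _ _ = inj₁ (refl , record
  { between = [] ; alternating = nil ; dominated = [] ; sum≡ = refl ; extends = λ d → d })
interpolate {s} (step {l} {m} {λ′} {μ} p q D) d d′
  with m≤n⇒m<n∨m≡n p | interpolate D (Linked.tail d) (Linked.tail d′)
... | inj₂ e | inj₁ (e′ , I) = inj₁ (e , record
  { between     = m ∷ I.between
  ; alternating = equal m I.alternating
  ; dominated   = step (≤-reflexive (trans e total)) (≤-trans (≤-reflexive (sym (trans e total))) (m≤m+n _ s)) I.dominated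
  ; sum≡        = total
  ; extends     = λ { (x≥l ∷ _) → subst (_ ≥_) l≡m x≥l ∷ I.extends (subst (λ n → WeaklyDecreasing (n ∷ λ′)) l≡m d) }
  })
  where
  module I = Interpolant I
  total = cong (m +_) I.sum≡
  l≡m : l ≡ m
  l≡m = +-cancelʳ-≡ (sum λ′) l m (trans e (cong (m +_) (sym e′)))
-- The sums agree from this row on but not below it, so `l > m`, and the new entry `suc m` is still
-- at most `l`.
... | inj₂ e | inj₂ (lt , I) = inj₁ (e , record
  { between     = suc m ∷ I.between
  ; alternating = minus m I.alternating
  ; dominated   = step (≤-reflexive (trans e total)) (≤-trans (≤-reflexive (sym (trans e total))) (m≤m+n _ s)) I.dominated
  ; sum≡        = total
  ; extends     = λ { (x≥l ∷ _) → ≤-trans m<l x≥l ∷ weaken (I.extends d′) }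
  })
  where
  module I = Interpolant I
  total : m + sum μ ≡ suc m + sum I.between
  total = trans (cong (m +_) I.sum≡) (+-suc m _)
  m<l : m < l
  m<l = +-cancelʳ-< (sum λ′) m l (<-≤-trans (+-monoʳ-< m lt) (≤-reflexive (sym e)))
  weaken : ∀ {y ys} → WeaklyDecreasing (y ∷ ys) → WeaklyDecreasing (suc y ∷ ys)
  weaken [-]       = [-]
  weaken (p ∷ ds) = m≤n⇒m≤1+n p ∷ ds
-- Sums that differ here but agree below force `l < m`, so this row of `μ` has a box to remove.
interpolate {s} (step {l} {zero} {λ′} {μ} p q D) d d′ | inj₁ lt | inj₁ (e′ , I) =
  contradiction (≤-trans lt (≤-reflexive (sym e′))) (<⇒≱ (s≤s (m≤n+m (sum λ′) l)))
interpolate {s} (step {l} {suc m} {λ′} {μ} p q D) d d′ | inj₁ lt | inj₁ (e′ , I) = inj₂ (lt , record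
  { between     = m ∷ I.between
  ; alternating = plus m I.alternating
  ; dominated   = step (s≤s⁻¹ (subst (sum (l ∷ λ′) <_) total lt))
                       (s≤s⁻¹ (subst₂ _≤_ total (+-suc _ s) q)) I.dominated
  ; sum≡        = total
  ; extends     = λ { (x≥m ∷ _) → <⇒≤ x≥m ∷ lower (I.extends d) }
  })
  where
  module I = Interpolant I
  total : suc m + sum μ ≡ suc (m + sum I.between)
  total = cong (suc m +_) I.sum≡
  -- `I.extends d` allows `l` on top of the interpolant below; as `l ≤ m`, the shortened row `m`
  -- fits there as well.
  l≤m : l ≤ m
  l≤m = s≤s⁻¹ (+-cancelʳ-< (sum λ′) l (suc m) (<-≤-trans lt (≤-reflexive (cong (suc m +_) (sym e′)))))
  lower : ∀ {ys} → WeaklyDecreasing (l ∷ ys) → WeaklyDecreasing (m ∷ ys)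
  lower [-]      = [-]
  lower (p ∷ ds) = ≤-trans p l≤m ∷ ds
interpolate {s} (step {l} {m} {λ′} {μ} p q D) d d′ | inj₁ lt | inj₂ (_ , I) = inj₂ (lt , record
  { between     = m ∷ I.between
  ; alternating = equal m I.alternating
  ; dominated   = step (s≤s⁻¹ (subst (sum (l ∷ λ′) <_) total lt))
                       (s≤s⁻¹ (subst₂ _≤_ total (+-suc _ s) q)) I.dominated
  ; sum≡        = total
  ; extends     = λ { (x≥m ∷ _) → x≥m ∷ I.extends d′ }
  })
  where
  module I = Interpolant I
  total : m + sum μ ≡ suc (m + sum I.between)
  total = trans (cong (m +_) I.sum≡) (+-suc m _)

-- Suffix sums and conjugates

-- The entry of `conj λ′` at index `i`, counted from 0, and 0 beyond its end.
longerThan : ℕ → List ℕ → ℕ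
longerThan i λ′ = length (filter (λ x → suc i ≤? x) λ′)

take-run : ∀ c a k → take c (run a k) ≡ run a (c ⊓ k)
take-run zero    a k       = refl
take-run (suc c) a zero    = refl
take-run (suc c) a (suc k) = cong (a ∷_) (take-run c (suc a) k)

applyUpTo-run : ∀ {f} a k → (∀ i → f i ≡ a + i) → applyUpTo f k ≡ run a k
applyUpTo-run a zero    _  = refl
applyUpTo-run a (suc k) eq = cong₂ _∷_ (trans (eq 0) (+-identityʳ a))
                               (applyUpTo-run (suc a) k (λ i → trans (eq (suc i)) (+-suc a i)))

upTo-run : ∀ k → upTo k ≡ run 0 k
upTo-run k = applyUpTo-run 0 k (λ _ → refl)

-- Raising the cap from `k` to `suc k` adds one box to exactly the rows longer than `k`.
sum-⊓-suc : ∀ k λ′ → sum (map (suc k ⊓_) λ′) ≡ sum (map (k ⊓_) λ′) + longerThan k λ′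
sum-⊓-suc k []       = refl
sum-⊓-suc k (x ∷ xs) with suc k ≤? x
... | yes k<x = begin
  suc k ⊓ x + sum (map (suc k ⊓_) xs)       ≡⟨ cong₂ _+_ (trans (m≤n⇒m⊓n≡m k<x) (cong suc (sym (m≤n⇒m⊓n≡m (<⇒≤ k<x))))) (sum-⊓-suc k xs) ⟩
  suc (k ⊓ x) + (sum (map (k ⊓_) xs) + longerThan k xs) ≡⟨ +-assoc (suc (k ⊓ x)) _ _ ⟨
  suc (k ⊓ x + sum (map (k ⊓_) xs)) + longerThan k xs ≡⟨ +-suc _ _ ⟨
  k ⊓ x + sum (map (k ⊓_) xs) + suc (longerThan k xs) ≡⟨ cong (λ f → k ⊓ x + sum (map (k ⊓_) xs) + length f) (filter-accept (suc k ≤?_) k<x) ⟨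
  k ⊓ x + sum (map (k ⊓_) xs) + longerThan k (x ∷ xs) ∎
  where open ≡-Reasoning
... | no k≮x = begin
  suc k ⊓ x + sum (map (suc k ⊓_) xs)       ≡⟨ cong₂ _+_ (trans (m≥n⇒m⊓n≡n (m≤n⇒m≤1+n (≮⇒≥ k≮x))) (sym (m≥n⇒m⊓n≡n (≮⇒≥ k≮x)))) (sum-⊓-suc k xs) ⟩
  k ⊓ x + (sum (map (k ⊓_) xs) + longerThan k xs) ≡⟨ +-assoc (k ⊓ x) _ _ ⟨
  k ⊓ x + sum (map (k ⊓_) xs) + longerThan k xs ≡⟨ cong (λ f → k ⊓ x + sum (map (k ⊓_) xs) + length f) (filter-reject (suc k ≤?_) k≮x) ⟨
  k ⊓ x + sum (map (k ⊓_) xs) + longerThan k (x ∷ xs) ∎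
  where open ≡-Reasoning

sum-⊓ : ∀ k λ′ → sum (map (λ i → longerThan i λ′) (run 0 k)) ≡ sum (map (k ⊓_) λ′)
sum-⊓ zero λ′ = sym (zeros λ′)
  where
  zeros : ∀ λ′ → sum (map (0 ⊓_) λ′) ≡ 0
  zeros []       = refl
  zeros (_ ∷ xs) = zeros xs
sum-⊓ (suc k) λ′ = begin
  sum (map h (run 0 (suc k)))               ≡⟨ cong (sum ∘ map h) (trans (cong (run 0) (+-comm 1 k)) (run-++ 0 k 1)) ⟩
  sum (map h (run 0 k ++ k ∷ []))           ≡⟨ cong sum (map-++ h (run 0 k) (k ∷ [])) ⟩
  sum (map h (run 0 k) ++ h k ∷ [])         ≡⟨ sum-++ (map h (run 0 k)) (h k ∷ []) ⟩
  sum (map h (run 0 k)) + (h k + 0)         ≡⟨ cong₂ _+_ (sum-⊓ k λ′) (+-identityʳ (h k)) ⟩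
  sum (map (k ⊓_) λ′) + h k                 ≡⟨ sum-⊓-suc k λ′ ⟨
  sum (map (suc k ⊓_) λ′)                   ∎
  where
  open ≡-Reasoning
  h = λ i → longerThan i λ′

-- Both sides count the boxes in the first `c` columns of the diagram.
sum-take-conj : ∀ c λ′ → sum (take c (conj λ′)) ≡ sum (map (c ⊓_) λ′)
sum-take-conj c λ′ = begin
  sum (take c (map h (upTo largest)))       ≡⟨ cong (λ xs → sum (take c (map h xs))) (upTo-run largest) ⟩
  sum (take c (map h (run 0 largest)))      ≡⟨ cong sum (take-map c (run 0 largest)) ⟩
  sum (map h (take c (run 0 largest)))      ≡⟨ cong (sum ∘ map h) (take-run c 0 largest) ⟩
  sum (map h (run 0 (c ⊓ largest)))         ≡⟨ sum-⊓ (c ⊓ largest) λ′ ⟩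
  -- `conj` ends at the largest part, which lowers the cap to `c ⊓ largest`; no row reaches beyond
  -- `largest`.
  sum (map ((c ⊓ largest) ⊓_) λ′)           ≡⟨ cong sum (map-cong-local (All.map cap (≤-largest λ′))) ⟩
  sum (map (c ⊓_) λ′)                       ∎
  where
  open ≡-Reasoning
  largest = foldr _⊔_ 0 λ′
  h = λ i → longerThan i λ′
  ≤-largest : ∀ xs → All (_≤ foldr _⊔_ 0 xs) xs
  ≤-largest []       = []
  ≤-largest (x ∷ xs) = m≤m⊔n x _ ∷ All.map (λ p → ≤-trans p (m≤n⊔m x _)) (≤-largest xs)
  cap : ∀ {x} → x ≤ largest → (c ⊓ largest) ⊓ x ≡ c ⊓ x
  cap x≤ = trans (⊓-assoc c largest _) (cong (c ⊓_) (m≥n⇒m⊓n≡n x≤))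

sum-⊓-take : ∀ c k μ → sum (map (c ⊓_) μ) ≤ k * c + sum (drop k μ)
sum-⊓-take c zero    []       = z≤n
sum-⊓-take c zero    (m ∷ μ)  = +-mono-≤ (m⊓n≤n c m) (sum-⊓-take c zero μ)
sum-⊓-take c (suc k) []       = z≤n
sum-⊓-take c (suc k) (m ∷ μ)  = ≤-trans (+-mono-≤ (m⊓n≤m c m) (sum-⊓-take c k μ)) (≤-reflexive (sym (+-assoc c (k * c) _)))

sum-⊓-head : ∀ {c λ′} → WeaklyDecreasing (c ∷ λ′) → sum (map (c ⊓_) λ′) ≡ sum λ′
sum-⊓-head [-]      = refl
sum-⊓-head {c} {l ∷ ls} (c≥l ∷ d) = cong₂ _+_ (m≥n⇒m⊓n≡n c≥l) (sum-⊓-head (delete₂ (c≥l ∷ d)))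

-- Capping the rows at the length c of the first row of a suffix leaves that suffix intact.
suffix-sum-≤ : ∀ {λ′ μ} → WeaklyDecreasing λ′ → (∀ c → sum (map (c ⊓_) λ′) ≤ sum (map (c ⊓_) μ)) →
               ∀ k → sum (drop k λ′) ≤ sum (drop k μ)
suffix-sum-≤ {λ′} {μ} d capped k with drop k λ′ in eq
... | []     = z≤n
... | c ∷ ls = +-cancelˡ-≤ (k * c) _ _ (begin
  k * c + sum (c ∷ ls)    ≡⟨ split k λ′ d eq ⟨
  sum (map (c ⊓_) λ′)     ≤⟨ capped c ⟩
  sum (map (c ⊓_) μ)      ≤⟨ sum-⊓-take c k μ ⟩
  k * c + sum (drop k μ)  ∎)
  where
  open ≤-Reasoning
  head-≥ : ∀ k {x xs} → WeaklyDecreasing (x ∷ xs) → drop k (x ∷ xs) ≡ c ∷ ls → x ≥ c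
  head-≥ zero    _        refl = ≤-refl
  head-≥ (suc zero) (p ∷ d) refl = p
  head-≥ (suc (suc k)) (p ∷ d) e = ≤-trans (head-≥ (suc k) d e) p
  split : ∀ k λ′ → WeaklyDecreasing λ′ → drop k λ′ ≡ c ∷ ls → sum (map (c ⊓_) λ′) ≡ k * c + sum (c ∷ ls)
  split zero    _        d refl = cong₂ _+_ (⊓-idem c) (sum-⊓-head d)
  split (suc k) (x ∷ xs) d e    = trans
    (cong₂ _+_ (m≤n⇒m⊓n≡m (head-≥ (suc k) d e)) (split k xs (Linked.tail d) e)) (sym (+-assoc c (k * c) _))

-- `Dominated` relates lists of equal length, so the shorter partition receives trailing zeros.
padTo : List ℕ → List ℕ → List ℕ
padTo []      _        = []
padTo (_ ∷ μ) []       = 0 ∷ padTo μ []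
padTo (_ ∷ μ) (l ∷ ls) = l ∷ padTo μ ls

sum-padTo-[] : ∀ μ → sum (padTo μ []) ≡ 0
sum-padTo-[] []      = refl
sum-padTo-[] (_ ∷ μ) = sum-padTo-[] μ

trim-padTo : ∀ {λ′} μ → All (0 <_) λ′ → length λ′ ≤ length μ → trim (padTo μ λ′) ≡ λ′
trim-padTo {[]}         []      _        _       = refl
trim-padTo {[]}         (_ ∷ μ) _        _       = trim-padTo μ [] z≤n
trim-padTo {suc l ∷ λ′} (_ ∷ μ) (_ ∷ ps) (s≤s p) = cong (suc l ∷_) (trim-padTo μ ps p)

padTo-decreasing : ∀ {λ′} μ → WeaklyDecreasing λ′ → WeaklyDecreasing (padTo μ λ′)
padTo-decreasing []          _       = []
padTo-decreasing (_ ∷ [])    []      = [-]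
padTo-decreasing (_ ∷ [])    [-]     = [-]
padTo-decreasing (_ ∷ [])    (_ ∷ _) = [-]
padTo-decreasing (_ ∷ m ∷ μ) []      = z≤n ∷ padTo-decreasing (m ∷ μ) []
padTo-decreasing (_ ∷ m ∷ μ) [-]     = z≤n ∷ padTo-decreasing (m ∷ μ) []
padTo-decreasing (_ ∷ m ∷ μ) (p ∷ d) = p ∷ padTo-decreasing (m ∷ μ) d

sum-padTo : ∀ {λ′} μ → length λ′ ≤ length μ → sum (padTo μ λ′) ≡ sum λ′
sum-padTo {[]}     μ       _       = sum-padTo-[] μ
sum-padTo {l ∷ λ′} (_ ∷ μ) (s≤s p) = cong (l +_) (sum-padTo μ p)

dominated-padTo : ∀ {s} λ′ μ → length λ′ ≤ length μ → (∀ k → sum (drop k λ′) ≤ sum (drop k μ)) →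
                  (∀ k → sum (drop k μ) ≤ sum (drop k λ′) + s) → Dominated s (padTo μ λ′) μ
dominated-padTo []       []      _ _ _ = []
dominated-padTo []       (m ∷ μ) _ p q = step
  (≤-trans (≤-reflexive (sum-padTo-[] μ)) z≤n) (≤-trans (q 0) (m≤n+m _ _))
  (dominated-padTo [] μ z≤n (λ k → ≤-trans (≤-reflexive (cong sum (drop-[] {A = ℕ} k))) z≤n)
    (λ k → ≤-trans (q (suc k)) (≤-reflexive (cong (λ xs → sum xs + _) (sym (drop-[] {A = ℕ} k))))))
dominated-padTo {s} (l ∷ λ′) (m ∷ μ) (s≤s n) p q = step
  (≤-trans (≤-reflexive padded) (p 0)) (≤-trans (q 0) (≤-reflexive (cong (_+ s) (sym padded))))
  (dominated-padTo λ′ μ n (p ∘ suc) (q ∘ suc))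
  where padded = cong (l +_) (sum-padTo μ n)

-- If `λ′` had more rows, its suffix after the last row of `μ` would have positive sum against 0.
length-≤ : ∀ {λ′ μ} → All (0 <_) λ′ → (∀ k → sum (drop k λ′) ≤ sum (drop k μ)) → length λ′ ≤ length μ
length-≤ {[]}     _        _ = z≤n
length-≤ {l ∷ λ′} {[]} (l>0 ∷ _) p = contradiction (p 0) (<⇒≱ (≤-trans l>0 (m≤m+n l (sum λ′))))
length-≤ {l ∷ λ′} {m ∷ μ} (_ ∷ ps) p = s≤s (length-≤ {μ = μ} ps (p ∘ suc))

sum-take-drop : ∀ k (xs : List ℕ) → sum xs ≡ sum (take k xs) + sum (drop k xs)
sum-take-drop k xs = trans (cong sum (sym (take++drop≡id k xs))) (sum-++ (take k xs) (drop k xs))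

-- Here `s` is the difference of the sizes. The conjugate inequality gives the lower bounds on the
-- suffix sums of `μ`; comparing prefix sums with the totals gives the upper ones.
⊑⇒dominated : ∀ {λ′ μ} → IsPartition λ′ → λ′ ⊑ μ →
              ∃ λ s → (length λ′ ≤ length μ) × (sum μ ≡ sum λ′ + s) × Dominated s (padTo μ λ′) μ
⊑⇒dominated {λ′} {μ} (positive , decreasing) (prefix , conjugate) =
  s , shorter , total , dominated-padTo λ′ μ shorter suffix λ k → +-cancelˡ-≤ (sum (take k λ′)) _ _ (begin
    sum (take k λ′) + sum (drop k μ)         ≤⟨ +-monoˡ-≤ (sum (drop k μ)) (prefix k) ⟩
    sum (take k μ) + sum (drop k μ)          ≡⟨ sum-take-drop k μ ⟨
    sum μ                                    ≡⟨ total ⟩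
    sum λ′ + s                               ≡⟨ cong (_+ s) (sum-take-drop k λ′) ⟩
    sum (take k λ′) + sum (drop k λ′) + s    ≡⟨ +-assoc (sum (take k λ′)) _ s ⟩
    sum (take k λ′) + (sum (drop k λ′) + s)  ∎)
  where
  open ≤-Reasoning
  suffix : ∀ k → sum (drop k λ′) ≤ sum (drop k μ)
  suffix = suffix-sum-≤ decreasing λ c → subst₂ _≤_ (sum-take-conj c λ′) (sum-take-conj c μ) (conjugate c)
  s = sum μ ∸ sum λ′
  total : sum μ ≡ sum λ′ + s
  total = sym (m+[n∸m]≡n (suffix 0))
  shorter = length-≤ positive suffix

-- Standardisation

rank : List ℕ → ℕ → ℕ
rank v x = length (filter (_<? x) v)

rank-< : ∀ {z x} v → z < x → rank (z ∷ v) x ≡ suc (rank v x)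
rank-< {x = x} v z<x = cong length (filter-accept (_<? x) z<x)

rank-≥ : ∀ {z x} v → x ≤ z → rank (z ∷ v) x ≡ rank v x
rank-≥ {x = x} v x≤z = cong length (filter-reject (_<? x) (≤⇒≯ x≤z))

rank-mono-≤ : ∀ {x y} v → x ≤ y → rank v x ≤ rank v y
rank-mono-≤ [] _ = z≤n
rank-mono-≤ {x} {y} (z ∷ v) x≤y with <-≤-connex z x | <-≤-connex z y
... | inj₁ z<x | inj₁ z<y rewrite rank-< v z<x | rank-< v z<y = s≤s (rank-mono-≤ v x≤y)
... | inj₁ z<x | inj₂ y≤z = contradiction (<-≤-trans z<x x≤y) (≤⇒≯ y≤z)
... | inj₂ x≤z | inj₁ z<y rewrite rank-≥ v x≤z | rank-< v z<y = m≤n⇒m≤1+n (rank-mono-≤ v x≤y)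
... | inj₂ x≤z | inj₂ y≤z rewrite rank-≥ v x≤z | rank-≥ v y≤z = rank-mono-≤ v x≤y

-- Strictness comes from `x` itself, which is counted by `rank v y` but not by `rank v x`.
rank-mono-< : ∀ {x y v} → x ∈ v → x < y → rank v x < rank v y
rank-mono-< {x} {y} {_ ∷ v} (here refl) x<y rewrite rank-≥ {x} v ≤-refl | rank-< v x<y =
  s≤s (rank-mono-≤ v (<⇒≤ x<y))
rank-mono-< {x} {y} {z ∷ v} (there x∈v) x<y with <-≤-connex z x | <-≤-connex z y
... | inj₁ z<x | inj₁ z<y rewrite rank-< v z<x | rank-< v z<y = s≤s (rank-mono-< x∈v x<y)
... | inj₁ z<x | inj₂ y≤z = contradiction (<-trans z<x x<y) (≤⇒≯ y≤z)
... | inj₂ x≤z | inj₁ z<y rewrite rank-≥ v x≤z | rank-< v z<y = m≤n⇒m≤1+n (rank-mono-< x∈v x<y)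
... | inj₂ x≤z | inj₂ y≤z rewrite rank-≥ v x≤z | rank-≥ v y≤z = rank-mono-< x∈v x<y

rank-⇔ : ∀ {x y} v → x ∈ v → y ∈ v → x < y ⇔ rank v x < rank v y
rank-⇔ v x∈v y∈v = mk⇔ (rank-mono-< x∈v) λ lt → ≰⇒> λ y≤x → <⇒≱ lt (rank-mono-≤ v y≤x)

map-rank-increasing : ∀ {v} → AllPairs _<_ v → map (rank v) v ≡ run 0 (length v)
map-rank-increasing [] = refl
map-rank-increasing {x ∷ v} (x<v ∷ inc) = cong₂ _∷_
  (trans (rank-≥ v ≤-refl) (cong length (filter-none (_<? x) (All.map (λ x<y → ≤⇒≯ (<⇒≤ x<y)) x<v))))
  (begin
    map (rank (x ∷ v)) v      ≡⟨ map-cong-local (All.map (rank-< v) x<v) ⟩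
    map (suc ∘ rank v) v      ≡⟨ map-∘ v ⟩
    map suc (map (rank v) v)  ≡⟨ cong (map suc) (map-rank-increasing inc) ⟩
    map suc (run 0 (length v)) ≡⟨ map-run 1 0 (length v) ⟩
    run 1 (length v)          ∎)
  where open ≡-Reasoning

Unique-↭ : ∀ {v w} → v ↭ w → Unique v → Unique w
Unique-↭ p = PermSetoid.Unique-resp-↭ (setoid ℕ) (↭⇒↭ₛ p)

Unique-⊆ : ∀ {v w : List ℕ} → v ⊆ w → Unique w → Unique v
Unique-⊆ []         []       = []
Unique-⊆ (_ ∷ʳ s)   (_ ∷ u)  = Unique-⊆ s u
Unique-⊆ (refl ∷ s) (x∉ ∷ u) = Sub.All-resp-⊆ s x∉ ∷ Unique-⊆ s u

run-increasing : ∀ a k → AllPairs _<_ (run a k)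
run-increasing a zero    = []
run-increasing a (suc k) = run-≥ (suc a) k ∷ run-increasing (suc a) k

sort-increasing : ∀ {v} → Unique v → AllPairs _<_ (sort v)
sort-increasing {v} u = AllPairs.zipWith (λ (x≤y , x≢y) → ≤∧≢⇒< x≤y x≢y)
  (Linked.Linked⇒AllPairs ≤-trans (sort-↗ v) , Unique-↭ (↭-sym (sort-↭ v)) u)

-- Ranks do not depend on the order of the letters, so they can be read off the sorted word, where
-- they are 0, 1, 2, ....
map-rank-↭ : ∀ {v} → Unique v → map (rank v) v ↭ run 0 (length v)
map-rank-↭ {v} u = begin
  map (rank v) v                ↭⟨ Perm.map⁺ (rank v) (sort-↭ v) ⟨
  map (rank v) (sort v)         ≡⟨ map-cong (λ x → Perm.↭-length (Perm.filter-↭ (_<? x) (↭-sym (sort-↭ v)))) (sort v) ⟩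
  map (rank (sort v)) (sort v)  ≡⟨ map-rank-increasing (sort-increasing u) ⟩
  run 0 (length (sort v))       ≡⟨ cong (run 0) (Perm.↭-length (sort-↭ v)) ⟩
  run 0 (length v)              ∎
  where open PermutationReasoning

toPerm : ∀ {w n} → w ↭ run 0 n → Perm
toPerm {w} {n} p = w , ↭-trans p (↭-reflexive (trans
  (cong (run 0) (trans (sym (length-run 0 n)) (sym (Perm.↭-length p)))) (sym (upTo-run (length w)))))

orderIso-map : ∀ {P : ℕ → Set} {f : ℕ → ℕ} → (∀ {x y} → P x → P y → x < y ⇔ f x < f y) →
               ∀ {w} → All P w → OrderIso (map f w) w
orderIso-map mono []                = []
orderIso-map {f = f} mono (px ∷ pw) = pointwise pw ∷ orderIso-map mono pw
  where
  pointwise : ∀ {w} → All _ w → Pointwise _ (map f w) w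
  pointwise []        = []
  pointwise (py ∷ pw) = (⇔-sym (mono px py) , ⇔-sym (mono py px)) ∷ pointwise pw

-- Young classes

Contains : (Perm → Set) → List ℕ → Set
Contains C μ = ∃ λ π → C π × sh π ≡ trim μ

-- The Young property puts `big` into the class, having the shape of a known member; closure under
-- subpermutations then puts the standardisation of `small` there.
contains-realised : ∀ {C μ ν} → IsYoungClass C → Realised μ ν → Contains C μ → Contains C ν
contains-realised {C} (closed , young) R (π , Cπ , eq) =
  σ , closed σ τ (small , sublist , orderIso-map (rank-⇔ small) members) Cτ ,
  trans (shape-map (rank-⇔ small) small members) shape-small
  where
  open Realised R
  members : All (_∈ small) small
  members = All.tabulate λ x∈ → x∈
  unique : Unique small
  unique = Unique-⊆ sublist (Unique-↭ (↭-sym permutation) (AllPairs.map <⇒≢ (run-increasing 0 size)))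
  τ = toPerm permutation
  σ = toPerm (map-rank-↭ unique)
  Cτ : C τ
  Cτ = young π τ (trans eq (sym shape-big)) Cπ

-- Induction on the difference in size: each interpolant is one box smaller than `μ` and still
-- dominates `λ′`.
contains-dominated : ∀ {C λ′ μ} s → IsYoungClass C → Dominated s λ′ μ → sum μ ≡ sum λ′ + s →
                     WeaklyDecreasing λ′ → WeaklyDecreasing μ → Contains C μ → Contains C λ′
contains-dominated zero _ D _ _ _ c with refl ← dominated-0 D = c
contains-dominated {λ′ = λ′} {μ} (suc s) Y D total dλ dμ c with interpolate D dλ dμ
-- Equal sums are impossible, since `μ` has `suc s` more boxes.
... | inj₁ (e , _) = contradiction (≤-reflexive (trans (sym total) (sym e))) (<⇒≱ (m<m+n (sum λ′) (s≤s z≤n)))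
... | inj₂ (_ , I) = contains-dominated s Y dominated (suc-injective (trans (sym sum≡) (trans total (+-suc (sum λ′) s)))) dλ dν
                       (contains-realised Y (realise alternating dμ dν) c)
  where
  open Interpolant I
  dν : WeaklyDecreasing between
  -- `extends` requires some entry on top of `μ`; `sum μ` is large enough.
  dν = Linked.tail (extends {sum μ} (bounded dμ))
    where
    bounded : ∀ {ls} → WeaklyDecreasing ls → WeaklyDecreasing (sum ls ∷ ls)
    bounded []           = [-]
    bounded {l ∷ ls} d@([-])   = m≤m+n l _ ∷ d
    bounded {l ∷ ls} d@(_ ∷ _) = m≤m+n l _ ∷ d

trim-positive : ∀ {ls} → All (0 <_) ls → trim ls ≡ ls
trim-positive []                  = refl
trim-positive {suc l ∷ ls} (_ ∷ p) = cong (suc l ∷_) (trim-positive p)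

theorem7 : (C : Perm → Set) → IsPermClass C →
    (IsYoungClass C ⇔ (∃ λ (D : List ℕ → Set) →
    IsPartitionSet D × DownClosed D × (∀ π → (C π ⇔ D (sh π)))))
theorem7 C closed = mk⇔ to from
  where
  to : IsYoungClass C → ∃ λ (D : List ℕ → Set) →
       IsPartitionSet D × DownClosed D × (∀ π → (C π ⇔ D (sh π)))
  to Y@(_ , young) = Shapes , partitions , downClosed ,
    λ π → mk⇔ (λ Cπ → π , Cπ , refl) (λ (σ , Cσ , eq) → young σ π eq Cσ)
    where
    -- `D` consists of the shapes of members of `C`; by the Young property these shapes determine
    -- the class.
    Shapes : List ℕ → Set
    Shapes λ′ = ∃ λ π → C π × sh π ≡ λ′
    partitions : IsPartitionSet Shapes
    partitions _ (π , _ , refl) = shape-partition (proj₁ π)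
    downClosed : DownClosed Shapes
    downClosed λ′ μ pλ@(λ>0 , dλ) (μ>0 , dμ) (π , Cπ , eq) λ⊑μ
      -- Zeros extend `λ′` to the length of `μ`, and `trim` removes them at the end.
      with s , shorter , total , D ← ⊑⇒dominated pλ λ⊑μ
      with σ , Cσ , eq′ ← contains-dominated s Y D
             (trans total (cong (_+ s) (sym (sum-padTo μ shorter)))) (padTo-decreasing μ dλ) dμ
             (π , Cπ , trans eq (sym (trim-positive μ>0)))
      = σ , Cσ , trans eq′ (trim-padTo μ λ>0 shorter)
  from : (∃ λ (D : List ℕ → Set) → IsPartitionSet D × DownClosed D × (∀ π → (C π ⇔ D (sh π)))) →
         IsYoungClass C
  from (D , _ , _ , C⇔D) = closed , λ π π′ eq Cπ →
    Equivalence.from (C⇔D π′) (subst D eq (Equivalence.to (C⇔D π) Cπ))
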